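{- Let $u\ge2$ and let $q$ be a prime power with $q\equiv 2^u+1\pmod{2^{u+1}}$. Let $t\ge u+1$, $N=2^t$ and $f=2^{t-u}$. Let $\omega$ be a primitive element of $\mathbb{F}_{q^f}$ and for $h=0,1,\dots,N-1$ let $D_h=\bigcup_{j=0}^{N/2-1}\omega^{h+j}\langle\omega^N\rangle\subset\mathbb{F}_{q^f}$ (exponents read modulo $N$). Then $\{D_{2^{t-u}\ell}:\ell=0,1,\dots,2^{u-1}-1\}$ is a skew Hadamard difference family in $(\mathbb{F}_{q^f},+)$.
   Context: Let $(G,+)$ be a finite abelian group of order $v$. A difference family with parameters $(v,k,\lambda)$ in $G$ is a family of $k$-subsets of $G$ (blocks) such that the list of differences $x-y$, $x\ne y$, with $x,y$ in a common block (counted over all blocks) contains every nonzero element of $G$ exactly $\lambda$ times. A block $B$ is skew if $B\cap(-B)=\emptyset$ and $B\cup(-B)=G\setminus\{0_G\}$; a difference family is skew Hadamard if all its blocks are skew. -}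

module Defs where

open import Level using (0ℓ)
open import Data.Nat using (ℕ; zero; suc; _+_; _*_; _^_; _≥_; _<_; _/_)
open import Data.Nat.Primality using (Prime)
open import Data.Fin using (Fin)
open import Data.List using (List; []; _∷_; length; concatMap; map; allFin)
open import Data.List.Relation.Unary.Unique.Propositional using (Unique)
open import Data.List.Membership.Propositional using (_∈_)
open import Data.Product using (Σ; ∃; ∃-syntax; _×_; _,_)
open import Data.Sum using (_⊎_)
open import Relation.Nullary using (¬_)
open import Relation.Binary.PropositionalEquality using (_≡_; _≢_)
open import Relation.Binary.Definitions using (DecidableEquality)
open import Algebra.Structures using (IsCommutativeRing)

IsPrimePower : ℕ → Set
IsPrimePower q = ∃[ p ] ∃[ m ] (Prime p × m ≥ 1 × q ≡ p ^ m)

record FiniteField : Set₁ where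
  field
    Carrier : Set
    _+F_ : Carrier → Carrier → Carrier
    _*F_ : Carrier → Carrier → Carrier
    -F_ : Carrier → Carrier
    0F : Carrier
    1F : Carrier
    isCommutativeRing : IsCommutativeRing _≡_ _+F_ _*F_ -F_ 0F 1F
    0≢1 : 0F ≢ 1F
    inverse : ∀ x → x ≢ 0F → ∃[ y ] (x *F y ≡ 1F)
    _≟F_ : DecidableEquality Carrier
    elems : List Carrier
    elems-unique : Unique elems
    elems-complete : ∀ x → x ∈ elems

  order : ℕ
  order = length elems

  _-F_ : Carrier → Carrier → Carrier
  x -F y = x +F (-F y)

  _^F_ : Carrier → ℕ → Carrier
  x ^F zero = 1F
  x ^F suc n = x *F (x ^F n)

open FiniteField public

IsPrimitive : (F : FiniteField) → Carrier F → Set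
IsPrimitive F ω = ∀ x → x ≢ 0F F → ∃[ e ] (x ≡ _^F_ F ω e)

-- D_h = ⋃_{j=0}^{N/2-1} ω^{h+j} ⟨ω^N⟩ , as a predicate on F.
-- ⟨ω^N⟩ = { (ω^N)^k : k ∈ ℕ }, so x ∈ D_h iff x = ω^{h+j+N k} for some j < N/2, k.
D : (F : FiniteField) → Carrier F → (N h : ℕ) → Carrier F → Set
D F ω N h x = ∃[ j ] ∃[ k ] (j < N / 2 × x ≡ _^F_ F ω (h + j + N * k))

data Count {A : Set} (P : A → Set) : List A → ℕ → Set where
  []  : Count P [] 0
  yes : ∀ {x xs n} → P x → Count P xs n → Count P (x ∷ xs) (suc n)
  no  : ∀ {x xs n} → ¬ P x → Count P xs n → Count P (x ∷ xs) n

triples : (F : FiniteField) (b : ℕ) → List (Fin b × Carrier F × Carrier F)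
triples F b = concatMap (λ i → concatMap (λ x → map (λ y → (i , x , y)) (elems F)) (elems F)) (allFin b)

IsDifferenceFamily : (F : FiniteField) (b : ℕ) (B : Fin b → Carrier F → Set) (v k λ' : ℕ) → Set
IsDifferenceFamily F b B v k λ' =
  order F ≡ v
  × (∀ i → Count (B i) (elems F) k)
  × (∀ g → g ≢ 0F F →
       Count (λ { (i , x , y) → B i x × B i y × x ≢ y × _-F_ F x y ≡ g }) (triples F b) λ')

IsSkew : (F : FiniteField) → (Carrier F → Set) → Set
IsSkew F B =
  (∀ x → B x → ¬ B (-F_ F x))
  × ¬ B (0F F)
  × (∀ x → x ≢ 0F F → B x ⊎ B (-F_ F x))

IsSkewHadamardDF : (F : FiniteField) (b : ℕ) (B : Fin b → Carrier F → Set) → Set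
IsSkewHadamardDF F b B =
  (∃[ v ] ∃[ k ] ∃[ λ' ] IsDifferenceFamily F b B v k λ') × (∀ i → IsSkew F (B i))

{-# OPTIONS --safe #-}

-- Let S be the function on 𝔽 with values 0 at 0 and (-1)^⌊2e/N⌋ at ω^e, so that D_h is the set
-- where S(ω^{-h} x) = 1.  Since S is odd, the theorem says that the autocorrelations of the
-- functions S(ω^{-fℓ} x) sum to a constant away from 0.  The usual argument expands S in
-- multiplicative characters χ of order dividing N and uses that the Gauss sums satisfy
-- G(χ^q) = G(χ) and |G(χ)|² = |𝔽|.  Here it is carried out over ℤ: the additive character is
-- replaced by μ(x) = #{y : y^q - y = x} - 1, which satisfies μ(x^q + z) = μ(x + z), ∑μ = 0 and
-- μ(0) > 0.  Let K be the group generated by ω^f.  For c ∉ bK some power Q of q makes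
-- x ↦ c^{Q-1} x^Q a permutation of b⁻¹K that changes the sign of S, whence
-- ∑_{x ∈ b⁻¹K} S(x) μ(cx + z) = 0.  This localisation to cosets of K replaces G(χ^q) = G(χ), and
-- ∑_c μ(cw) = 0 for w ≠ 0 replaces |G(χ)|² = |𝔽|.

module Submission where

open import Defs using
  (FiniteField; IsPrimitive; D; Count; triples; IsDifferenceFamily; IsSkew; IsSkewHadamardDF)

open import Level using (0ℓ)
open import Function using (_∘_; id)
open import Algebra.Bundles using (CommutativeRing)
open import Data.Nat using
  ( ℕ; zero; suc; pred; _+_; _*_; _^_; _∸_; _≤_; _<_; _≥_; _/_; _%_; NonZero; >-nonZero; >-nonZero⁻¹
  ; z≤n; s≤s; z<s; s<s; s≤s⁻¹)
import Data.Nat.Properties as ℕ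
open import Data.Nat.Combinatorics using (_C_; nCn≡1; nC1≡n; nCk+nC[k+1]≡[n+1]C[k+1])
open import Data.Nat.Combinatorics.Specification using (k>n⇒nCk≡0)
open import Data.Nat.DivMod using (m≡m%n+[m/n]*n; m%n<n; m<n⇒m/n≡0; m*n/n≡m; +-distrib-/-∣ˡ)
open import Data.Nat.Divisibility using
  ( _∣_; divides; _∣?_; ∣⇒≤; m∣m*n; n∣m*n; 1∣_; ∣m∣n⇒∣m+n; ∣m+n∣m⇒∣n; ∣m⇒∣m*n; ∣-trans
  ; *-cancelˡ-∣; *-monoʳ-∣)
open import Data.Nat.Primality using (Prime; euclidsLemma)
import Data.Nat.Tactic.RingSolver as ℕ-solver
open import Data.Integer as ℤ using (ℤ; +_; 0ℤ; 1ℤ; -1ℤ)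
  renaming (_+_ to _+ᶻ_; _*_ to _*ᶻ_; -_ to -ᶻ_; _-_ to _-ᶻ_)
import Data.Integer.Properties as ℤ
open import Data.Integer.Tactic.RingSolver using (solve-∀)
open import Algebra.Properties.Ring ℤ.+-*-ring using () renaming (+-cancelˡ to +ᶻ-cancelˡ)
open import Data.Fin as Fin using (Fin; toℕ; inject₁; fromℕ)
import Data.Fin.Properties as Fin
import Data.Fin.Permutation as Perm
open import Data.List using
  ( List; []; _∷_; _++_; _∷ʳ_; map; concatMap; length; lookup; upTo; applyUpTo; tabulate; allFin)
open import Data.List.Properties using (length-upTo; map-upTo; upTo-∷ʳ)
open import Data.List.Membership.Propositional using (_∈_)
open import Data.List.Membership.Propositional.Properties using (∈-lookup; ∈-upTo⁺)
open import Data.List.Relation.Unary.All as All using (All)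
open import Data.List.Relation.Unary.AllPairs using ([]; _∷_)
open import Data.List.Relation.Unary.Any using (here; there; index)
open import Data.List.Relation.Unary.Any.Properties using (lookup-index)
open import Data.List.Relation.Unary.Unique.Propositional using (Unique)
open import Data.Product using (∃-syntax; _×_; _,_; proj₁; proj₂)
open import Data.Sum as Sum using (_⊎_; inj₁; inj₂; [_,_]′)
open import Relation.Nullary using (¬_; Dec; yes; no; contradiction; toSum; ¬?; _×-dec_)
open import Relation.Nullary.Decidable using (map′)
open import Relation.Binary.Definitions using (DecidableEquality)
open import Relation.Binary.PropositionalEquality

-- The hypothesis on q says that 2^u is the exact power of 2 dividing q - 1, so 2^(u+j) is the exact
-- power dividing q^(2^j) - 1. For j = t - u this makes -1 an odd power of ω^(N/2), so S is odd.
-- Smaller j give the sign change: if c = ω^a b and 2^e is the exact power of 2 in a, with e < t -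
-- u, then Q = q^(2^j) with j = t - u - 1 - e makes (Q - 1)a an odd multiple of N/2, while (Q - 1)f
-- is an even one. In terms of characters, μ(x) is the sum of ψ(c Tr x) over nonzero c in F_q, where
-- Tr is the trace to F_q and ψ a nontrivial additive character of F_q; this is why it takes integer
-- values. The autocorrelations are averaged over K because, for k in K, the dilation of S by k can
-- be traded for the frequency k⁻¹b in place of b. As k runs through K this frequency runs through
-- bK, and localisation makes a sum over bK equal to a sum over all frequencies. The latter
-- collapses a double sum over x and y to x + y = 0.

private variable
  A B : Set

-- Indicators, finite integer sums and counting

indicator : {P : Set} → Dec P → ℤ
indicator (yes _) = 1ℤ
indicator (no _)  = 0ℤ

indicator-yes : {P : Set} (P? : Dec P) → P → indicator P? ≡ 1ℤ
indicator-yes (yes _) _ = refl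
indicator-yes (no ¬p) p = contradiction p ¬p

indicator-no : {P : Set} (P? : Dec P) → ¬ P → indicator P? ≡ 0ℤ
indicator-no (yes p) ¬p = contradiction p ¬p
indicator-no (no _) _ = refl

indicator-⇔ : {P Q : Set} (P? : Dec P) (Q? : Dec Q) → (P → Q) → (Q → P) →
              indicator P? ≡ indicator Q?
indicator-⇔ (yes p) Q? f g = sym (indicator-yes Q? (f p))
indicator-⇔ (no ¬p) Q? f g = sym (indicator-no Q? (¬p ∘ g))

indicator-nonneg : {P : Set} (P? : Dec P) → 0ℤ ℤ.≤ indicator P?
indicator-nonneg (yes _) = ℤ.+≤+ z≤n
indicator-nonneg (no _)  = ℤ.≤-refl

indicator-bit : {P : Set} (P? : Dec P) → indicator P? ≡ 0ℤ ⊎ indicator P? ≡ 1ℤ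
indicator-bit (yes _) = inj₂ refl
indicator-bit (no _)  = inj₁ refl

indicator≡1⇒ : {P : Set} (P? : Dec P) → indicator P? ≡ 1ℤ → P
indicator≡1⇒ (yes p) _ = p

indicator-× : {P Q : Set} (P? : Dec P) (Q? : Dec Q) → indicator (P? ×-dec Q?) ≡ indicator P? *ᶻ indicator Q?
indicator-× (yes _) (yes _) = refl
indicator-× (yes _) (no _)  = refl
indicator-× (no _)  _       = refl

∑[_] : List A → (A → ℤ) → ℤ
∑[ [] ] f     = 0ℤ
∑[ x ∷ xs ] f = f x +ᶻ ∑[ xs ] f

∑-cong : (xs : List A) {f g : A → ℤ} → (∀ x → f x ≡ g x) → ∑[ xs ] f ≡ ∑[ xs ] g
∑-cong []       eq = refl
∑-cong (x ∷ xs) eq = cong₂ _+ᶻ_ (eq x) (∑-cong xs eq)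

∑-zero : (xs : List A) → ∑[ xs ] (λ _ → 0ℤ) ≡ 0ℤ
∑-zero []       = refl
∑-zero (x ∷ xs) = trans (ℤ.+-identityˡ _) (∑-zero xs)

∑-+ : (xs : List A) (f g : A → ℤ) → ∑[ xs ] (λ x → f x +ᶻ g x) ≡ ∑[ xs ] f +ᶻ ∑[ xs ] g
∑-+ []       f g = refl
∑-+ (x ∷ xs) f g = trans (cong ((f x +ᶻ g x) +ᶻ_) (∑-+ xs f g)) (interchange (f x) (g x) (∑[ xs ] f) (∑[ xs ] g))
  where
  interchange : ∀ a b c d → (a +ᶻ b) +ᶻ (c +ᶻ d) ≡ (a +ᶻ c) +ᶻ (b +ᶻ d)
  interchange = solve-∀

∑-*ˡ : (xs : List A) (c : ℤ) (f : A → ℤ) → ∑[ xs ] (λ x → c *ᶻ f x) ≡ c *ᶻ ∑[ xs ] f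
∑-*ˡ []       c f = sym (ℤ.*-zeroʳ c)
∑-*ˡ (x ∷ xs) c f = trans (cong (c *ᶻ f x +ᶻ_) (∑-*ˡ xs c f)) (sym (ℤ.*-distribˡ-+ c (f x) _))

∑-*ʳ : (xs : List A) (c : ℤ) (f : A → ℤ) → ∑[ xs ] (λ x → f x *ᶻ c) ≡ ∑[ xs ] f *ᶻ c
∑-*ʳ xs c f = trans (∑-cong xs (λ x → ℤ.*-comm (f x) c))
                    (trans (∑-*ˡ xs c f) (ℤ.*-comm c _))

∑-neg : (xs : List A) (f : A → ℤ) → ∑[ xs ] (λ x → -ᶻ f x) ≡ -ᶻ ∑[ xs ] f
∑-neg []       f = refl
∑-neg (x ∷ xs) f = trans (cong (-ᶻ f x +ᶻ_) (∑-neg xs f)) (sym (ℤ.neg-distrib-+ (f x) _))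

∑-swap : (xs : List A) (ys : List B) (f : A → B → ℤ) →
         ∑[ xs ] (λ x → ∑[ ys ] (f x)) ≡ ∑[ ys ] (λ y → ∑[ xs ] (λ x → f x y))
∑-swap []       ys f = sym (∑-zero ys)
∑-swap (x ∷ xs) ys f = trans (cong (∑[ ys ] (f x) +ᶻ_) (∑-swap xs ys f)) (sym (∑-+ ys (f x) _))

∑-const : (xs : List A) (c : ℤ) → ∑[ xs ] (λ _ → c) ≡ + length xs *ᶻ c
∑-const []       c = refl
∑-const (x ∷ xs) c = trans (cong (c +ᶻ_) (∑-const xs c)) (sym (ℤ.suc-* (+ length xs) c))

∑-mono : (xs : List A) {f g : A → ℤ} → (∀ x → f x ℤ.≤ g x) → ∑[ xs ] f ℤ.≤ ∑[ xs ] g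
∑-mono []       le = ℤ.≤-refl
∑-mono (x ∷ xs) le = ℤ.+-mono-≤ (le x) (∑-mono xs le)

∑-++ : (xs ys : List A) (f : A → ℤ) → ∑[ xs ++ ys ] f ≡ ∑[ xs ] f +ᶻ ∑[ ys ] f
∑-++ []       ys f = sym (ℤ.+-identityˡ _)
∑-++ (x ∷ xs) ys f = trans (cong (f x +ᶻ_) (∑-++ xs ys f)) (sym (ℤ.+-assoc (f x) _ _))

∑-map : (h : B → A) (xs : List B) (f : A → ℤ) → ∑[ map h xs ] f ≡ ∑[ xs ] (f ∘ h)
∑-map h []       f = refl
∑-map h (x ∷ xs) f = cong (f (h x) +ᶻ_) (∑-map h xs f)

∑-concatMap : (h : B → List A) (xs : List B) (f : A → ℤ) →
              ∑[ concatMap h xs ] f ≡ ∑[ xs ] (λ x → ∑[ h x ] f)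
∑-concatMap h []       f = refl
∑-concatMap h (x ∷ xs) f =
  trans (∑-++ (h x) _ f) (cong (∑[ h x ] f +ᶻ_) (∑-concatMap h xs f))

∑-∈ : {A : Set} {xs : List A} {f : A → ℤ} → (∀ x → 0ℤ ℤ.≤ f x) → ∀ {x} → x ∈ xs → f x ℤ.≤ ∑[ xs ] f
∑-∈ {xs = x ∷ xs} {f} nonneg (here refl) =
  ℤ.≤-trans (ℤ.≤-reflexive (sym (ℤ.+-identityʳ (f x))))
    (ℤ.+-monoʳ-≤ (f x) (ℤ.≤-trans (ℤ.≤-reflexive (sym (∑-zero xs))) (∑-mono xs nonneg)))
∑-∈ {xs = y ∷ xs} {f} nonneg {x} (there x∈) =
  ℤ.≤-trans (ℤ.≤-reflexive (sym (ℤ.+-identityˡ (f x)))) (ℤ.+-mono-≤ (nonneg y) (∑-∈ nonneg x∈))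

∑-upTo-suc : ∀ n (f : ℕ → ℤ) → ∑[ upTo (suc n) ] f ≡ f 0 +ᶻ ∑[ upTo n ] (f ∘ suc)
∑-upTo-suc n f = cong (f 0 +ᶻ_) (trans (cong (λ xs → ∑[ xs ] f) (sym (map-upTo suc n))) (∑-map suc (upTo n) f))

∑-allFin : ∀ n (f : ℕ → ℤ) → ∑[ allFin n ] (f ∘ toℕ) ≡ ∑[ upTo n ] f
∑-allFin n f = go n id id (λ _ → refl)
  where
  go : {A : Set} (n : ℕ) {g : A → ℤ} (h : Fin n → A) (ψ : ℕ → ℕ) → (∀ i → g (h i) ≡ f (ψ (toℕ i))) →
       ∑[ tabulate h ] g ≡ ∑[ applyUpTo ψ n ] f
  go zero    h ψ eq = refl
  go (suc n) h ψ eq = cong₂ _+ᶻ_ (eq Fin.zero) (go n (h ∘ Fin.suc) (ψ ∘ suc) (eq ∘ Fin.suc))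

-- Rotation by one step: splitting `upTo (suc n)` at its first or at its last index leaves over
-- `g 0` or `g n`, which agree by periodicity.
∑-cyclic : ∀ n (f : ℕ → ℤ) → (∀ i → f (i + n) ≡ f i) → ∀ j → ∑[ upTo n ] (λ i → f (j + i)) ≡ ∑[ upTo n ] f
∑-cyclic n f periodic zero    = refl
∑-cyclic n f periodic (suc j) = trans (+ᶻ-cancelˡ (g 0) _ _ (begin
  g 0 +ᶻ ∑[ upTo n ] (λ i → f (suc j + i))
    ≡⟨ cong (g 0 +ᶻ_) (∑-cong (upTo n) (λ i → cong f (sym (ℕ.+-suc j i)))) ⟩
  g 0 +ᶻ ∑[ upTo n ] (g ∘ suc)             ≡⟨ ∑-upTo-suc n g ⟨
  ∑[ upTo (suc n) ] g                      ≡⟨ cong (λ xs → ∑[ xs ] g) (upTo-∷ʳ n) ⟨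
  ∑[ upTo n ∷ʳ n ] g                       ≡⟨ ∑-++ (upTo n) (n ∷ []) g ⟩
  ∑[ upTo n ] g +ᶻ (g n +ᶻ 0ℤ)
    ≡⟨ cong (∑[ upTo n ] g +ᶻ_) (trans (ℤ.+-identityʳ (g n)) (trans (periodic j) (cong f (sym (ℕ.+-identityʳ j))))) ⟩
  ∑[ upTo n ] g +ᶻ g 0                     ≡⟨ ℤ.+-comm _ (g 0) ⟩
  g 0 +ᶻ ∑[ upTo n ] g                     ∎)) (∑-cyclic n f periodic j)
  where
  open ≡-Reasoning
  g : ℕ → ℤ
  g i = f (j + i)

-- `Count` is a relation, so the number is produced together with its derivation; the equation in ℤ
-- allows it to be identified later by evaluating a sum.
count : {A : Set} {P : A → Set} (P? : ∀ x → Dec (P x)) (xs : List A) →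
        ∃[ n ] (Count P xs n × + n ≡ ∑[ xs ] (λ x → indicator (P? x)))
count P? [] = 0 , Count.[] , refl
count P? (x ∷ xs) with P? x | count P? xs
... | yes px | n , c , eq = suc n , Count.yes px c , cong (1ℤ +ᶻ_) eq
... | no ¬px | n , c , eq = n , Count.no ¬px c , trans eq (sym (ℤ.+-identityˡ _))

lookup-injective : {A : Set} {xs : List A} → Unique xs → ∀ i j → lookup xs i ≡ lookup xs j → i ≡ j
lookup-injective (h ∷ u) Fin.zero    Fin.zero    eq = refl
lookup-injective {xs = _ ∷ xs} (h ∷ u) Fin.zero (Fin.suc j) eq = contradiction eq (All.lookup h (∈-lookup {xs = xs} j))
lookup-injective {xs = _ ∷ xs} (h ∷ u) (Fin.suc i) Fin.zero eq = contradiction (sym eq) (All.lookup h (∈-lookup {xs = xs} i))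
lookup-injective (h ∷ u) (Fin.suc i) (Fin.suc j) eq = cong Fin.suc (lookup-injective u i j eq)

module Enumerated (_≟_ : DecidableEquality A) (elems : List A)
                  (elems-unique : Unique elems) (elems-complete : ∀ x → x ∈ elems) where

  ∑ : (A → ℤ) → ℤ
  ∑ = ∑[ elems ]

  δ : A → A → ℤ
  δ a x = indicator (a ≟ x)

  δ-refl : ∀ a → δ a a ≡ 1ℤ
  δ-refl a = indicator-yes (a ≟ a) refl

  δ-≢ : ∀ {a x} → a ≢ x → δ a x ≡ 0ℤ
  δ-≢ {a} {x} = indicator-no (a ≟ x)

  δ-*-cong : ∀ a (f : A → ℤ) x → δ a x *ᶻ f x ≡ δ a x *ᶻ f a
  δ-*-cong a f x with a ≟ x
  ... | yes refl = refl
  ... | no _     = refl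

  private
    ∑-δ-∉ : ∀ a xs → All (a ≢_) xs → ∑[ xs ] (δ a) ≡ 0ℤ
    ∑-δ-∉ a []       All.[]        = refl
    ∑-δ-∉ a (x ∷ xs) (a≢x All.∷ h) = cong₂ _+ᶻ_ (δ-≢ a≢x) (∑-δ-∉ a xs h)

    ∑-δ-∈ : ∀ a xs → Unique xs → a ∈ xs → ∑[ xs ] (δ a) ≡ 1ℤ
    ∑-δ-∈ a (x ∷ xs) (h ∷ _) (here refl) = cong₂ _+ᶻ_ (δ-refl a) (∑-δ-∉ a xs h)
    ∑-δ-∈ a (x ∷ xs) (h ∷ u) (there a∈)  =
      cong₂ _+ᶻ_ (δ-≢ (All.lookup h a∈ ∘ sym)) (∑-δ-∈ a xs u a∈)

  ∑-δ : ∀ a → ∑ (δ a) ≡ 1ℤ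
  ∑-δ a = ∑-δ-∈ a elems elems-unique (elems-complete a)

  ∑-δ-* : ∀ a (f : A → ℤ) → ∑ (λ x → δ a x *ᶻ f x) ≡ f a
  ∑-δ-* a f = begin
    ∑ (λ x → δ a x *ᶻ f x) ≡⟨ ∑-cong elems (δ-*-cong a f) ⟩
    ∑ (λ x → δ a x *ᶻ f a) ≡⟨ ∑-*ʳ elems (f a) (δ a) ⟩
    ∑ (δ a) *ᶻ f a         ≡⟨ cong (_*ᶻ f a) (∑-δ a) ⟩
    1ℤ *ᶻ f a              ≡⟨ ℤ.*-identityˡ (f a) ⟩
    f a                    ∎
    where open ≡-Reasoning

  -- Inserting `δ (π x) y` turns the change of variables into an exchange of two sums, so the order
  -- of `elems` is never touched.
  ∑-reindex : (π π⁻¹ : A → A) → (∀ x → π⁻¹ (π x) ≡ x) → (∀ y → π (π⁻¹ y) ≡ y) →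
              (f : A → ℤ) → ∑ (f ∘ π) ≡ ∑ f
  ∑-reindex π π⁻¹ left right f = begin
    ∑ (λ x → f (π x))                     ≡⟨ ∑-cong elems (λ x → ∑-δ-* (π x) f) ⟨
    ∑ (λ x → ∑ (λ y → δ (π x) y *ᶻ f y))  ≡⟨ ∑-swap elems elems _ ⟩
    ∑ (λ y → ∑ (λ x → δ (π x) y *ᶻ f y))
      ≡⟨ ∑-cong elems (λ y → ∑-cong elems (λ x → cong (_*ᶻ f y) (flip-δ x y))) ⟩
    ∑ (λ y → ∑ (λ x → δ (π⁻¹ y) x *ᶻ f y)) ≡⟨ ∑-cong elems (λ y → ∑-δ-* (π⁻¹ y) (λ _ → f y)) ⟩
    ∑ f                                   ∎
    where
    open ≡-Reasoning
    flip-δ : ∀ x y → δ (π x) y ≡ δ (π⁻¹ y) x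
    flip-δ x y = indicator-⇔ (π x ≟ y) (π⁻¹ y ≟ x)
      (λ { refl → left x }) (λ { refl → right y })

-- Binomial coefficients, 2-adic divisibility and signs

-- Division-free form of the ratio of neighbouring binomial coefficients; for `suc n` prime it
-- exhibits that prime as a divisor of the left side.
absorption : ∀ n k → suc k * (suc n C suc k) ≡ suc n * (n C k)
absorption zero zero = refl
absorption zero (suc k) = trans (cong (suc (suc k) *_) (k>n⇒nCk≡0 (s≤s (s≤s (z≤n {k})))))
  (trans (ℕ.*-zeroʳ (suc (suc k))) (cong (1 *_) (sym (k>n⇒nCk≡0 (s≤s (z≤n {k}))))))
absorption (suc n) zero = trans (ℕ.*-identityˡ _) (trans (nC1≡n (suc (suc n))) (sym (ℕ.*-identityʳ _)))
absorption (suc n) (suc k) = begin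
  k+2 * (suc (suc n) C k+2)                     ≡⟨ cong (k+2 *_) (nCk+nC[k+1]≡[n+1]C[k+1] (suc n) (suc k)) ⟨
  k+2 * (a + (suc n C k+2))                     ≡⟨ ℕ.*-distribˡ-+ k+2 a _ ⟩
  (a + suc k * a) + k+2 * (suc n C k+2)
    ≡⟨ cong₂ (λ s t → (a + s) + t) (absorption n k) (absorption n (suc k)) ⟩
  (a + suc n * (n C k)) + suc n * (n C suc k)   ≡⟨ ℕ.+-assoc a _ _ ⟩
  a + (suc n * (n C k) + suc n * (n C suc k))   ≡⟨ cong (λ r → a + r) (ℕ.*-distribˡ-+ (suc n) (n C k) _) ⟨
  a + suc n * (n C k + n C suc k)               ≡⟨ cong (λ s → a + suc n * s) (nCk+nC[k+1]≡[n+1]C[k+1] n k) ⟩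
  suc (suc n) * a                               ∎
  where
  open ≡-Reasoning
  k+2 = suc (suc k)
  a = suc n C suc k

prime∣binomial : ∀ {p k} → Prime (suc p) → suc k < suc p → suc p ∣ (suc p C suc k)
prime∣binomial {p} {k} p-prime k<p with euclidsLemma (suc k) (suc p C suc k) p-prime
    (divides (p C k) (trans (absorption p k) (ℕ.*-comm (suc p) _)))
... | inj₁ p∣k = contradiction (∣⇒≤ p∣k) (ℕ.<⇒≱ k<p)
... | inj₂ p∣C = p∣C

x≡-x⇒x≡0 : ∀ x → x ≡ -ᶻ x → x ≡ 0ℤ
x≡-x⇒x≡0 (+ 0) eq = refl

parity : ∀ m → ∃[ k ] (m ≡ 2 * k ⊎ m ≡ 1 + 2 * k)
parity zero = 0 , inj₁ refl
parity (suc m) with parity m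
... | k , inj₁ refl = k , inj₂ refl
... | k , inj₂ refl = suc k , inj₁ (step k)
  where
  step : ∀ k → 2 + 2 * k ≡ 2 * suc k
  step = ℕ-solver.solve-∀

odd≢even : ∀ a b → 1 + 2 * a ≢ 2 * b
odd≢even a zero ()
odd≢even zero (suc b) eq rewrite ℕ.+-suc b (b + 0) with () ← eq
odd≢even (suc a) (suc b) eq rewrite ℕ.+-suc a (a + 0) | ℕ.+-suc b (b + 0) =
  odd≢even a b (ℕ.suc-injective (ℕ.suc-injective eq))

-- Writing `s` as `e + suc j` records that the exact power of 2 in `m` has exponent `e` below `s`;
-- the gap `j` later selects the power of Frobenius in `twist`.
2^∤-decompose : ∀ s m → ¬ 2 ^ s ∣ m → ∃[ e ] ∃[ j ] ∃[ p ] (s ≡ e + suc j × m ≡ 2 ^ e * (1 + 2 * p))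
2^∤-decompose zero m ∤ = contradiction (1∣ m) ∤
2^∤-decompose (suc s) m ∤ with parity m
... | p , inj₂ refl = 0 , s , p , refl , sym (ℕ.*-identityˡ _)
... | k , inj₁ refl with e , j , p , refl , refl ← 2^∤-decompose s k (∤ ∘ *-monoʳ-∣ 2) =
  suc e , j , p , refl , sym (ℕ.*-assoc 2 (2 ^ e) _)

2^∣-cancel-odd : ∀ s a r → 2 ^ s ∣ a * (1 + 2 * r) → 2 ^ s ∣ a
2^∣-cancel-odd zero a r _ = 1∣ a
2^∣-cancel-odd (suc s) a r d@(divides c eq) with parity a
... | k , inj₁ refl = *-monoʳ-∣ 2 (2^∣-cancel-odd s k r (*-cancelˡ-∣ 2 (subst (2 ^ suc s ∣_) (ℕ.*-assoc 2 k _) d)))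
... | k , inj₂ refl = contradiction
  (trans (sym (odd k r)) (trans eq (even c (2 ^ s)))) (odd≢even (k + r + 2 * (k * r)) (c * 2 ^ s))
  where
  odd : ∀ k r → (1 + 2 * k) * (1 + 2 * r) ≡ 1 + 2 * (k + r + 2 * (k * r))
  odd = ℕ-solver.solve-∀
  even : ∀ c b → c * (2 * b) ≡ 2 * (c * b)
  even = ℕ-solver.solve-∀

-- Squaring 1 + y gives 1 + 2y(1 + y/2). Since 4 divides y, the factor 1 + y/2 is odd, so each
-- squaring raises the exact power of 2 by one. This is where u ≥ 2 enters.
[1+4W·odd]^2^ : ∀ {q} W m → q ≡ suc (4 * W * (1 + 2 * m)) →
  ∀ j → ∃[ o ] (q ^ (2 ^ j) ≡ suc (4 * W * 2 ^ j * (1 + 2 * o)))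
[1+4W·odd]^2^ {q} W m eq zero = m , trans (ℕ.*-identityʳ q) (trans eq (cong suc (shape W m)))
  where
  shape : ∀ W m → 4 * W * (1 + 2 * m) ≡ 4 * W * 1 * (1 + 2 * m)
  shape = ℕ-solver.solve-∀
[1+4W·odd]^2^ {q} W m eq (suc j) with o , ih ← [1+4W·odd]^2^ W m eq j =
  o + (1 + 2 * o) * (W * 2 ^ j * (1 + 2 * o)) , (begin
    q ^ (2 * 2 ^ j)         ≡⟨ cong (q ^_) (ℕ.*-comm 2 (2 ^ j)) ⟩
    q ^ (2 ^ j * 2)         ≡⟨ ℕ.^-*-assoc q (2 ^ j) 2 ⟨
    (q ^ (2 ^ j)) ^ 2       ≡⟨ cong (_^ 2) ih ⟩
    suc (4 * W * 2 ^ j * (1 + 2 * o)) ^ 2 ≡⟨ square W (2 ^ j) o ⟩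
    suc (4 * W * (2 * 2 ^ j) * (1 + 2 * (o + (1 + 2 * o) * (W * 2 ^ j * (1 + 2 * o))))) ∎)
  where
  open ≡-Reasoning
  square : ∀ W J o →
    (1 + 4 * W * J * (1 + 2 * o)) * ((1 + 4 * W * J * (1 + 2 * o)) * 1) ≡
    1 + 4 * W * (2 * J) * (1 + 2 * (o + (1 + 2 * o) * (W * J * (1 + 2 * o))))
  square = ℕ-solver.solve-∀

sign : ℕ → ℤ
sign zero    = 1ℤ
sign (suc n) = -ᶻ sign n

sign-+ : ∀ m n → sign (m + n) ≡ sign m *ᶻ sign n
sign-+ zero    n = sym (ℤ.*-identityˡ _)
sign-+ (suc m) n = trans (cong -ᶻ_ (sign-+ m n)) (ℤ.neg-distribˡ-* (sign m) (sign n))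

sign-even : ∀ k → sign (2 * k) ≡ 1ℤ
sign-even zero = refl
sign-even (suc k) rewrite ℕ.+-suc k (k + 0) = trans (ℤ.neg-involutive _) (sign-even k)

sign-odd : ∀ k → sign (1 + 2 * k) ≡ -1ℤ
sign-odd k = cong -ᶻ_ (sign-even k)

sign-square : ∀ k → sign k *ᶻ sign k ≡ 1ℤ
sign-square k with parity k
... | m , inj₁ refl rewrite sign-even m = refl
... | m , inj₂ refl rewrite sign-even m = refl

sign≡1⇒even : ∀ k → sign k ≡ 1ℤ → ∃[ m ] k ≡ 2 * m
sign≡1⇒even k eq with parity k
... | m , inj₁ k≡2m = m , k≡2m
... | m , inj₂ refl rewrite sign-even m with () ← eq

sign-bit : ∀ k → sign k ≡ 1ℤ ⊎ sign k ≡ -1ℤ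
sign-bit k with parity k
... | m , inj₁ refl = inj₁ (sign-even m)
... | m , inj₂ refl = inj₂ (sign-odd m)

-- Arithmetic of finite fields: inverses, characteristic, additivity of Frobenius

module FieldProperties (F : FiniteField) where

  open FiniteField F public
    using (elems; elems-unique; elems-complete; order; 0≢1)
    renaming ( Carrier to 𝔽; 0F to 𝟘; 1F to 𝟙; -F_ to infix 8 ⊖_
             ; _+F_ to infixl 6 _⊕_; _*F_ to infixl 7 _⊗_; _^F_ to infixl 9 _↑_
             ; _≟F_ to infix 4 _≟_; inverse to ∃-inverse )

  commutativeRing : CommutativeRing 0ℓ 0ℓ
  commutativeRing = record { isCommutativeRing = FiniteField.isCommutativeRing F }

  module R = CommutativeRing commutativeRing
  open import Algebra.Properties.Ring R.ring public
    using (-1*x≈-x; -‿distribʳ-*; -‿involutive; -0#≈0#; +-inverseʳ-unique; +-cancelʳ)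
  open import Algebra.Properties.AbelianGroup R.+-abelianGroup public using (⁻¹-∙-comm)
  open import Algebra.Properties.Semiring.Mult R.semiring using ()
    renaming (_×_ to _•_; ×-assocˡ to •-assocˡ; ×1-homo-* to •1-homo-*; ×-assoc-* to •-assoc-⊗; ×-homo-1 to •-homo-1)
  open import Algebra.Properties.Semiring.Sum R.semiring
    using (sum; sum-init-last; sum-permute; ∑-distrib-+; sum-cong-≗; sum-replicate; sum-replicate-zero)
  import Algebra.Properties.Semiring.Exp R.semiring as Exp
  import Algebra.Properties.CommutativeSemiring.Binomial R.commutativeSemiring as Binomial
  open import Algebra.Solver.Ring.NaturalCoefficients.Default R.commutativeSemiring public
    using (solve; _:*_; _:+_; _:=_)

  ↑-+ : ∀ x m n → x ↑ (m + n) ≡ x ↑ m ⊗ x ↑ n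
  ↑-+ x zero    n = sym (R.*-identityˡ _)
  ↑-+ x (suc m) n = trans (cong (x ⊗_) (↑-+ x m n)) (sym (R.*-assoc x _ _))

  ↑-* : ∀ x m n → x ↑ (m * n) ≡ x ↑ n ↑ m
  ↑-* x zero    n = refl
  ↑-* x (suc m) n = trans (↑-+ x n (m * n)) (cong (x ↑ n ⊗_) (↑-* x m n))

  ↑-⊗ : ∀ x y n → (x ⊗ y) ↑ n ≡ x ↑ n ⊗ y ↑ n
  ↑-⊗ x y zero    = sym (R.*-identityˡ 𝟙)
  ↑-⊗ x y (suc n) = trans (cong (x ⊗ y ⊗_) (↑-⊗ x y n))
    (solve 4 (λ a b c d → (a :* b) :* (c :* d) := (a :* c) :* (b :* d)) refl x y (x ↑ n) (y ↑ n))

  𝟙↑ : ∀ n → 𝟙 ↑ n ≡ 𝟙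
  𝟙↑ zero    = refl
  𝟙↑ (suc n) = trans (R.*-identityˡ _) (𝟙↑ n)

  ⊗-integral : ∀ x y → x ⊗ y ≡ 𝟘 → x ≢ 𝟘 → y ≡ 𝟘
  ⊗-integral x y xy≡0 x≢0 with x⁻¹ , xx⁻¹≡1 ← ∃-inverse x x≢0 = begin
    y               ≡⟨ R.*-identityˡ y ⟨
    𝟙 ⊗ y           ≡⟨ cong (_⊗ y) (trans (sym xx⁻¹≡1) (R.*-comm x x⁻¹)) ⟩
    x⁻¹ ⊗ x ⊗ y     ≡⟨ R.*-assoc x⁻¹ x y ⟩
    x⁻¹ ⊗ (x ⊗ y)   ≡⟨ cong (x⁻¹ ⊗_) xy≡0 ⟩
    x⁻¹ ⊗ 𝟘         ≡⟨ R.zeroʳ x⁻¹ ⟩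
    𝟘               ∎
    where open ≡-Reasoning

  ⊗-≢𝟘 : ∀ {x y} → x ≢ 𝟘 → y ≢ 𝟘 → x ⊗ y ≢ 𝟘
  ⊗-≢𝟘 {x} {y} x≢0 y≢0 xy≡0 = y≢0 (⊗-integral x y xy≡0 x≢0)

  ↑-≢𝟘 : ∀ {x} n → x ≢ 𝟘 → x ↑ n ≢ 𝟘
  ↑-≢𝟘 zero    x≢0 = 0≢1 ∘ sym
  ↑-≢𝟘 (suc n) x≢0 = ⊗-≢𝟘 x≢0 (↑-≢𝟘 n x≢0)

  -- With the value 0 at 0 this is an involution of the whole field, which allows reindexing by it;
  -- it also makes `κ (c ⊗ inv b)` vanish at `b ≡ 𝟘`.
  inv : 𝔽 → 𝔽
  inv x with x ≟ 𝟘
  ... | yes _  = 𝟘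
  ... | no x≢0 = proj₁ (∃-inverse x x≢0)

  inv-𝟘 : inv 𝟘 ≡ 𝟘
  inv-𝟘 with 𝟘 ≟ 𝟘
  ... | yes _  = refl
  ... | no 0≢0 = contradiction refl 0≢0

  ⊗-inv : ∀ {x} → x ≢ 𝟘 → x ⊗ inv x ≡ 𝟙
  ⊗-inv {x} x≢0 with x ≟ 𝟘
  ... | yes x≡0 = contradiction x≡0 x≢0
  ... | no x≢0  = proj₂ (∃-inverse x x≢0)

  inv-⊗-cancel : ∀ {x} → x ≢ 𝟘 → ∀ y → inv x ⊗ (x ⊗ y) ≡ y
  inv-⊗-cancel {x} x≢0 y = trans (sym (R.*-assoc (inv x) x y))
    (trans (cong (_⊗ y) (trans (R.*-comm (inv x) x) (⊗-inv x≢0))) (R.*-identityˡ y))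

  ⊗-inv-cancel : ∀ {x} → x ≢ 𝟘 → ∀ y → x ⊗ (inv x ⊗ y) ≡ y
  ⊗-inv-cancel {x} x≢0 y = trans (sym (R.*-assoc x (inv x) y))
    (trans (cong (_⊗ y) (⊗-inv x≢0)) (R.*-identityˡ y))

  ⊗-cancelˡ : ∀ {x y z} → x ≢ 𝟘 → x ⊗ y ≡ x ⊗ z → y ≡ z
  ⊗-cancelˡ {x} {y} {z} x≢0 eq =
    trans (sym (inv-⊗-cancel x≢0 y)) (trans (cong (inv x ⊗_) eq) (inv-⊗-cancel x≢0 z))

  inv-≢𝟘 : ∀ {x} → x ≢ 𝟘 → inv x ≢ 𝟘
  inv-≢𝟘 {x} x≢0 eq = 0≢1 (trans (sym (R.zeroʳ x)) (trans (cong (x ⊗_) (sym eq)) (⊗-inv x≢0)))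

  inv-unique : ∀ {x y} → x ⊗ y ≡ 𝟙 → inv x ≡ y
  inv-unique {x} {y} xy≡1 = ⊗-cancelˡ x≢0 (trans (⊗-inv x≢0) (sym xy≡1))
    where
    x≢0 : x ≢ 𝟘
    x≢0 refl = 0≢1 (trans (sym (R.zeroˡ y)) xy≡1)

  inv-⊗ : ∀ {x y} → x ≢ 𝟘 → y ≢ 𝟘 → inv (x ⊗ y) ≡ inv x ⊗ inv y
  inv-⊗ {x} {y} x≢0 y≢0 = inv-unique (trans
    (solve 4 (λ x y x′ y′ → (x :* y) :* (x′ :* y′) := (x :* x′) :* (y :* y′)) refl x y (inv x) (inv y))
    (trans (cong₂ _⊗_ (⊗-inv x≢0) (⊗-inv y≢0)) (R.*-identityˡ 𝟙)))

  inv-involutive : ∀ x → inv (inv x) ≡ x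
  inv-involutive x with x ≟ 𝟘 in eq
  ... | yes refl = inv-𝟘
  ... | no x≢0 with x⁻¹ , xx⁻¹≡1 ← ∃-inverse x x≢0 = inv-unique (trans (R.*-comm x⁻¹ x) xx⁻¹≡1)

  private
    element : Fin order → 𝔽
    element = lookup elems

  position : 𝔽 → Fin order
  position x = index (elems-complete x)

  private
    element-position : ∀ x → element (position x) ≡ x
    element-position x = sym (lookup-index (elems-complete x))

    position-element : ∀ i → position (element i) ≡ i
    position-element i = lookup-injective elems-unique _ _ (element-position (element i))

  position-injective : ∀ {x y} → position x ≡ position y → x ≡ y
  position-injective {x} {y} eq =
    trans (sym (element-position x)) (trans (cong element eq) (element-position y))

  -- Translation by 𝟙 permutes the field, so the sum of all elements absorbs order • 𝟙.
  order•𝟙 : order • 𝟙 ≡ 𝟘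
  order•𝟙 = begin
    order • 𝟙                        ≡⟨ R.+-identityˡ _ ⟨
    𝟘 ⊕ order • 𝟙                    ≡⟨ cong (_⊕ order • 𝟙) (R.-‿inverseˡ s) ⟨
    (⊖ s ⊕ s) ⊕ order • 𝟙            ≡⟨ R.+-assoc (⊖ s) s _ ⟩
    ⊖ s ⊕ (s ⊕ order • 𝟙)            ≡⟨ cong (λ t → ⊖ s ⊕ (s ⊕ t)) (sum-replicate order) ⟨
    ⊖ s ⊕ (s ⊕ sum (λ (_ : Fin order) → 𝟙)) ≡⟨ cong (⊖ s ⊕_) (∑-distrib-+ element (λ _ → 𝟙)) ⟨
    ⊖ s ⊕ sum (λ i → element i ⊕ 𝟙)  ≡⟨ cong (⊖ s ⊕_) (sum-cong-≗ (λ i → element-position (element i ⊕ 𝟙))) ⟨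
    ⊖ s ⊕ sum (λ i → element (shift i)) ≡⟨ cong (⊖ s ⊕_) (sum-permute element π) ⟨
    ⊖ s ⊕ s                          ≡⟨ R.-‿inverseˡ s ⟩
    𝟘                                ∎
    where
    open ≡-Reasoning
    s = sum element
    shift unshift : Fin order → Fin order
    shift i   = position (element i ⊕ 𝟙)
    unshift i = position (element i ⊕ ⊖ 𝟙)
    cancel : ∀ x y z → y ⊕ z ≡ 𝟘 → x ⊕ y ⊕ z ≡ x
    cancel x y z eq = trans (R.+-assoc x y z) (trans (cong (x ⊕_) eq) (R.+-identityʳ x))
    π = Perm.permutation shift unshift
      (λ i → trans (cong (λ x → position (x ⊕ 𝟙)) (element-position _))
        (trans (cong position (cancel _ _ _ (R.-‿inverseˡ 𝟙))) (position-element i)))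
      (λ i → trans (cong (λ x → position (x ⊕ ⊖ 𝟙)) (element-position _))
        (trans (cong position (cancel _ _ _ (R.-‿inverseʳ 𝟙))) (position-element i)))

  ^•𝟙≡𝟘 : ∀ p m → (p ^ m) • 𝟙 ≡ 𝟘 → p • 𝟙 ≡ 𝟘
  ^•𝟙≡𝟘 p zero eq = contradiction (trans (sym eq) (•-homo-1 𝟙)) 0≢1
  ^•𝟙≡𝟘 p (suc m) eq with p • 𝟙 ≟ 𝟘
  ... | yes p≡0 = p≡0
  ... | no p≢0  = ^•𝟙≡𝟘 p m (⊗-integral _ _ (trans (sym (•1-homo-* p (p ^ m))) eq) p≢0)

  Additive : ℕ → Set
  Additive m = ∀ x y → (x ⊕ y) ↑ m ≡ x ↑ m ⊕ y ↑ m

  additive-1 : Additive 1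
  additive-1 x y = trans (R.*-identityʳ _) (sym (cong₂ _⊕_ (R.*-identityʳ x) (R.*-identityʳ y)))

  additive-* : ∀ m n → Additive m → Additive n → Additive (m * n)
  additive-* m n +m +n x y = begin
    (x ⊕ y) ↑ (m * n)             ≡⟨ ↑-* (x ⊕ y) m n ⟩
    (x ⊕ y) ↑ n ↑ m               ≡⟨ cong (_↑ m) (+n x y) ⟩
    (x ↑ n ⊕ y ↑ n) ↑ m           ≡⟨ +m (x ↑ n) (y ↑ n) ⟩
    x ↑ n ↑ m ⊕ y ↑ n ↑ m         ≡⟨ cong₂ _⊕_ (↑-* x m n) (↑-* y m n) ⟨
    x ↑ (m * n) ⊕ y ↑ (m * n)     ∎
    where open ≡-Reasoning

  additive-^ : ∀ m k → Additive m → Additive (m ^ k)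
  additive-^ m zero    +m = additive-1
  additive-^ m (suc k) +m = additive-* m (m ^ k) +m (additive-^ m k +m)

  -- Only the extreme terms of the binomial expansion survive: the other coefficients are multiples
  -- of p, and p annihilates the field.
  additive-prime : ∀ {p} → Prime p → p • 𝟙 ≡ 𝟘 → Additive p
  additive-prime {suc p} p-prime p•𝟙≡𝟘 x y = begin
    (x ⊕ y) ↑ suc p                               ≡⟨ ↑≡^ (x ⊕ y) (suc p) ⟩
    (x ⊕ y) Exp.^ suc p                           ≡⟨ Binomial.theorem (suc p) x y ⟩
    t Fin.zero ⊕ sum (λ k → t (Fin.suc k))
      ≡⟨ cong (t Fin.zero ⊕_) (sum-init-last {p} (λ k → t (Fin.suc k))) ⟩
    t Fin.zero ⊕ (sum (λ k → t (Fin.suc (inject₁ k))) ⊕ t (Fin.suc (fromℕ p)))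
      ≡⟨ cong₂ _⊕_ first (cong₂ _⊕_ (trans (sum-cong-≗ middle) (sum-replicate-zero p)) last) ⟩
    y ↑ suc p ⊕ (𝟘 ⊕ x ↑ suc p)                   ≡⟨ cong (y ↑ suc p ⊕_) (R.+-identityˡ _) ⟩
    y ↑ suc p ⊕ x ↑ suc p                         ≡⟨ R.+-comm _ _ ⟩
    x ↑ suc p ⊕ y ↑ suc p                         ∎
    where
    open ≡-Reasoning
    ↑≡^ : ∀ x n → x ↑ n ≡ x Exp.^ n
    ↑≡^ x zero    = refl
    ↑≡^ x (suc n) = cong (x ⊗_) (↑≡^ x n)
    t : Fin (suc (suc p)) → 𝔽
    t = Binomial.binomialTerm x y (suc p)
    p•≡𝟘 : ∀ z → suc p • z ≡ 𝟘
    p•≡𝟘 z = begin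
      suc p • z         ≡⟨ cong (suc p •_) (R.*-identityˡ z) ⟨
      suc p • (𝟙 ⊗ z)   ≡⟨ •-assoc-⊗ (suc p) 𝟙 z ⟨
      suc p • 𝟙 ⊗ z     ≡⟨ cong (_⊗ z) p•𝟙≡𝟘 ⟩
      𝟘 ⊗ z             ≡⟨ R.zeroˡ z ⟩
      𝟘                 ∎
    •𝟘 : ∀ n → n • 𝟘 ≡ 𝟘
    •𝟘 n = trans (sym (sum-replicate n)) (sum-replicate-zero n)
    multiple : ∀ {n} z → suc p ∣ n → n • z ≡ 𝟘
    multiple z (divides c refl) =
      trans (sym (•-assocˡ z c (suc p))) (trans (cong (c •_) (p•≡𝟘 z)) (•𝟘 c))
    first : t Fin.zero ≡ y ↑ suc p
    first = trans (•-homo-1 _) (trans (R.*-identityˡ _) (sym (↑≡^ y (suc p))))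
    middle : ∀ k → t (Fin.suc (inject₁ k)) ≡ 𝟘
    middle k = multiple _ (prime∣binomial p-prime
      (s<s (subst (_< p) (sym (Fin.toℕ-inject₁ k)) (Fin.toℕ<n k))))
    last : t (Fin.suc (fromℕ p)) ≡ x ↑ suc p
    last = begin
      (suc p C suc (toℕ (fromℕ p))) • (x Exp.^ suc (toℕ (fromℕ p)) ⊗ y Exp.^ (p ∸ toℕ (fromℕ p)))
        ≡⟨ cong (λ j → (suc p C suc j) • (x Exp.^ suc j ⊗ y Exp.^ (p ∸ j))) (Fin.toℕ-fromℕ p) ⟩
      (suc p C suc p) • (x Exp.^ suc p ⊗ y Exp.^ (p ∸ p))
        ≡⟨ cong₂ (λ c j → c • (x Exp.^ suc p ⊗ y Exp.^ j)) (nCn≡1 (suc p)) (ℕ.n∸n≡0 p) ⟩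
      1 • (x Exp.^ suc p ⊗ 𝟙) ≡⟨ •-homo-1 _ ⟩
      x Exp.^ suc p ⊗ 𝟙       ≡⟨ R.*-identityʳ _ ⟩
      x Exp.^ suc p           ≡⟨ ↑≡^ x (suc p) ⟨
      x ↑ suc p               ∎

  -- The characteristic is recovered from the order: a power of p annihilates `𝟙`, and as there are
  -- no zero divisors p does so already.
  additive-primePower : ∀ {p m k} → Prime p → order ≡ (p ^ m) ^ k → Additive (p ^ m)
  additive-primePower {p} {m} {k} p-prime eq = additive-^ p m (additive-prime p-prime
    (^•𝟙≡𝟘 p (m * k) (subst (λ n → n • 𝟙 ≡ 𝟘) (trans eq (ℕ.^-*-assoc p m k)) order•𝟙)))

-- Sums over the field and their changes of variable

module FieldSums (F : FiniteField) where
  open FieldProperties F public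
  open Enumerated _≟_ elems elems-unique elems-complete public

  ∑-scale : ∀ {a} → a ≢ 𝟘 → (f : 𝔽 → ℤ) → ∑ (λ x → f (a ⊗ x)) ≡ ∑ f
  ∑-scale {a} a≢0 = ∑-reindex (a ⊗_) (inv a ⊗_) (inv-⊗-cancel a≢0) (⊗-inv-cancel a≢0)

  ∑-inv : (f : 𝔽 → ℤ) → ∑ (λ x → f (inv x)) ≡ ∑ f
  ∑-inv = ∑-reindex inv inv inv-involutive inv-involutive

  ∑-⊖ : (f : 𝔽 → ℤ) → ∑ (λ x → f (⊖ x)) ≡ ∑ f
  ∑-⊖ = ∑-reindex ⊖_ ⊖_ -‿involutive -‿involutive

  ⊕-⊖-cancel : ∀ x y → x ⊕ y ⊕ ⊖ y ≡ x
  ⊕-⊖-cancel x y = trans (R.+-assoc x y _) (trans (cong (x ⊕_) (R.-‿inverseʳ y)) (R.+-identityʳ x))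

  ⊖-⊕-cancel : ∀ x y → x ⊕ ⊖ y ⊕ y ≡ x
  ⊖-⊕-cancel x y = trans (R.+-assoc x _ y) (trans (cong (x ⊕_) (R.-‿inverseˡ y)) (R.+-identityʳ x))

  ∑-shift : ∀ z (f : 𝔽 → ℤ) → ∑ (λ x → f (x ⊕ z)) ≡ ∑ f
  ∑-shift z = ∑-reindex (_⊕ z) (_⊕ ⊖ z) (λ x → ⊕-⊖-cancel x z) (λ x → ⊖-⊕-cancel x z)

  ∑-odd : (f : 𝔽 → ℤ) → (∀ x → f (⊖ x) ≡ -ᶻ f x) → ∑ f ≡ 0ℤ
  ∑-odd f odd = x≡-x⇒x≡0 _ (trans (sym (∑-⊖ f)) (trans (∑-cong elems odd) (∑-neg elems f)))

  ∑-cong′ : {f g : 𝔽 → ℤ} → (∀ x → f x ≡ g x) → ∑ f ≡ ∑ g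
  ∑-cong′ = ∑-cong elems

  ⊖-transpose : ∀ {x y z} → x ⊕ ⊖ y ≡ z → x ⊕ ⊖ z ≡ y
  ⊖-transpose {x} {y} refl = begin
    x ⊕ ⊖ (x ⊕ ⊖ y)      ≡⟨ cong (x ⊕_) (⁻¹-∙-comm x (⊖ y)) ⟨
    x ⊕ (⊖ x ⊕ ⊖ (⊖ y))  ≡⟨ R.+-assoc x _ _ ⟨
    x ⊕ ⊖ x ⊕ ⊖ (⊖ y)    ≡⟨ cong₂ _⊕_ (R.-‿inverseʳ x) (-‿involutive y) ⟩
    𝟘 ⊕ y                ≡⟨ R.+-identityˡ y ⟩
    y                    ∎
    where open ≡-Reasoning

  difference-≢ : ∀ {x y z} → z ≢ 𝟘 → x ⊕ ⊖ y ≡ z → x ≢ y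
  difference-≢ {x} z≢0 eq refl = z≢0 (trans (sym eq) (R.-‿inverseʳ x))

  ∑-triples : ∀ b (φ : Fin b × 𝔽 × 𝔽 → ℤ) →
    ∑[ triples F b ] φ ≡ ∑[ allFin b ] (λ i → ∑ (λ x → ∑ (λ y → φ (i , x , y))))
  ∑-triples b φ = trans (∑-concatMap row (allFin b) φ) (∑-cong (allFin b) λ i →
    trans (∑-concatMap (cell i) elems φ) (∑-cong′ λ x → ∑-map (λ y → (i , x , y)) elems φ))
    where
    cell : Fin b → 𝔽 → List (Fin b × 𝔽 × 𝔽)
    cell i x = map (λ y → (i , x , y)) elems
    row : Fin b → List (Fin b × 𝔽 × 𝔽)
    row i = concatMap (cell i) elems

module _ (F : FiniteField) where

  open FieldSums F

  -- Autocorrelations of S averaged over the subgroup K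

  module Correlation (S κ μ : 𝔽 → ℤ)
    (S-odd : ∀ x → S (⊖ x) ≡ -ᶻ S x)
    (S² : ∀ {x} → x ≢ 𝟘 → S x *ᶻ S x ≡ 1ℤ)
    (κ-bit : ∀ x → κ x ≡ 0ℤ ⊎ κ x ≡ 1ℤ)
    (κ-𝟘 : κ 𝟘 ≡ 0ℤ)
    (κ-𝟙 : κ 𝟙 ≡ 1ℤ)
    (κ-⊖ : ∀ x → κ (⊖ x) ≡ κ x)
    (κ-⊗ : ∀ {x} → κ x ≡ 1ℤ → ∀ y → κ (x ⊗ y) ≡ κ y)
    (∑μ≡0 : ∑ μ ≡ 0ℤ)
    where

    open ≡-Reasoning

    -- κ is the indicator function of a subgroup K of 𝔽ˣ, so T is a sum over b⁻¹K.
    T : 𝔽 → 𝔽 → 𝔽 → ℤ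
    T b c z = ∑ λ x → S x *ᶻ (κ (b ⊗ x) *ᶻ μ (c ⊗ x ⊕ z))

    size : ℤ
    size = ∑ κ

    S-𝟘 : S 𝟘 ≡ 0ℤ
    S-𝟘 = x≡-x⇒x≡0 _ (trans (cong S (sym -0#≈0#)) (S-odd 𝟘))

    κ-idempotent : ∀ x → κ x *ᶻ κ x ≡ κ x
    κ-idempotent x with κ-bit x
    ... | inj₁ eq rewrite eq = refl
    ... | inj₂ eq rewrite eq = refl

    -- A factor `κ k` under a sum lets an equation be used that holds only for k in K.
    κ-*-cong : ∀ k {m n : ℤ} → (κ k ≡ 1ℤ → m ≡ n) → κ k *ᶻ m ≡ κ k *ᶻ n
    κ-*-cong k {m} {n} eq with κ-bit k
    ... | inj₁ k≡0 rewrite k≡0 = refl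
    ... | inj₂ k≡1 = cong (κ k *ᶻ_) (eq k≡1)

    κ≡1⇒≢𝟘 : ∀ {x} → κ x ≡ 1ℤ → x ≢ 𝟘
    κ≡1⇒≢𝟘 eq refl = contradiction (trans (sym eq) κ-𝟘) λ ()

    -- Apply `κ-⊗` to whichever of `x` and `inv x` lies in K: their product is `𝟙`, where κ is 1.
    κ-inv : ∀ x → κ (inv x) ≡ κ x
    κ-inv x = [ (λ { refl → cong κ inv-𝟘 }) , nonzero ]′ (toSum (x ≟ 𝟘))
     where
     nonzero : x ≢ 𝟘 → κ (inv x) ≡ κ x
     nonzero x≢0 with κ-bit x | κ-bit (inv x)
     ...   | inj₂ κx≡1 | _ = trans (sym (κ-⊗ κx≡1 (inv x))) (trans (cong κ (⊗-inv x≢0)) (trans κ-𝟙 (sym κx≡1)))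
     ...   | inj₁ κx≡0 | inj₁ κx⁻¹≡0 = trans κx⁻¹≡0 (sym κx≡0)
     ...   | inj₁ κx≡0 | inj₂ κx⁻¹≡1 = begin
      κ (inv x)       ≡⟨ κx⁻¹≡1 ⟩
      1ℤ              ≡⟨ κ-𝟙 ⟨
      κ 𝟙             ≡⟨ cong κ (trans (sym (⊗-inv x≢0)) (R.*-comm x (inv x))) ⟩
      κ (inv x ⊗ x)   ≡⟨ κ-⊗ κx⁻¹≡1 x ⟩
      κ x             ∎

    κ-nonneg : ∀ x → 0ℤ ℤ.≤ κ x
    κ-nonneg x with κ-bit x
    ... | inj₁ eq = ℤ.≤-reflexive (sym eq)
    ... | inj₂ eq = ℤ.≤-trans (ℤ.+≤+ z≤n) (ℤ.≤-reflexive (sym eq))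

    size≥1 : 1ℤ ℤ.≤ size
    size≥1 = subst (ℤ._≤ size) (∑-δ 𝟙) (∑-mono elems δ≤κ)
      where
      δ≤κ : ∀ x → δ 𝟙 x ℤ.≤ κ x
      δ≤κ x with 𝟙 ≟ x
      ... | yes refl = ℤ.≤-reflexive (sym κ-𝟙)
      ... | no _     = κ-nonneg x

    instance
      size-nonZero : ℤ.NonZero size
      size-nonZero = ℤ.>-nonZero (ℤ.<-≤-trans (ℤ.+<+ (s≤s z≤n)) size≥1)

    T-𝟘ˡ : ∀ c z → T 𝟘 c z ≡ 0ℤ
    T-𝟘ˡ c z = trans (∑-cong′ vanish) (∑-zero elems)
      where
      vanish : ∀ x → S x *ᶻ (κ (𝟘 ⊗ x) *ᶻ μ (c ⊗ x ⊕ z)) ≡ 0ℤ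
      vanish x rewrite R.zeroˡ x | κ-𝟘 = ℤ.*-zeroʳ (S x)

    -- At frequency 0 the factor μ is constant, and K is symmetric, so the summand is odd.
    T-𝟘ʳ : ∀ b z → T b 𝟘 z ≡ 0ℤ
    T-𝟘ʳ b z = ∑-odd _ λ x → begin
      S (⊖ x) *ᶻ (κ (b ⊗ ⊖ x) *ᶻ μ (𝟘 ⊗ ⊖ x ⊕ z))
        ≡⟨ cong₂ _*ᶻ_ (S-odd x) (cong₂ _*ᶻ_ (trans (cong κ (sym (-‿distribʳ-* b x))) (κ-⊖ (b ⊗ x)))
             (cong (λ w → μ (w ⊕ z)) (trans (R.zeroˡ _) (sym (R.zeroˡ x))))) ⟩
      -ᶻ S x *ᶻ (κ (b ⊗ x) *ᶻ μ (𝟘 ⊗ x ⊕ z))  ≡⟨ ℤ.neg-distribˡ-* (S x) _ ⟨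
      -ᶻ (S x *ᶻ (κ (b ⊗ x) *ᶻ μ (𝟘 ⊗ x ⊕ z))) ∎

    -- The counterpart of orthogonality of additive characters: for w ≠ 0 the map c ↦ cw + z
    -- permutes the field, and μ has sum 0.
    ∑-μ : ∀ w z → ∑ (λ c → μ (c ⊗ w ⊕ z)) ≡ δ 𝟘 w *ᶻ (+ order *ᶻ μ z)
    ∑-μ w z with 𝟘 ≟ w
    ... | yes refl = begin
      ∑ (λ c → μ (c ⊗ 𝟘 ⊕ z))  ≡⟨ ∑-cong′ (λ c → cong μ (trans (cong (_⊕ z) (R.zeroʳ c)) (R.+-identityˡ z))) ⟩
      ∑ (λ c → μ z)            ≡⟨ ∑-const elems (μ z) ⟩
      + order *ᶻ μ z           ≡⟨ ℤ.*-identityˡ _ ⟨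
      1ℤ *ᶻ (+ order *ᶻ μ z)   ∎
    ... | no 0≢w = begin
      ∑ (λ c → μ (c ⊗ w ⊕ z))  ≡⟨ ∑-cong′ (λ c → cong (λ t → μ (t ⊕ z)) (R.*-comm c w)) ⟩
      ∑ (λ c → μ (w ⊗ c ⊕ z))  ≡⟨ ∑-scale (0≢w ∘ sym) (λ c → μ (c ⊕ z)) ⟩
      ∑ (λ c → μ (c ⊕ z))      ≡⟨ ∑-shift z μ ⟩
      ∑ μ                      ≡⟨ ∑μ≡0 ⟩
      0ℤ                       ∎

    -- `orthogonal` says that `T b c z` vanishes for c outside bK, phrased as an equation so that it
    -- can be applied under sums over b or c.
    module _ (orthogonal : ∀ b c z → T b c z ≡ κ (c ⊗ inv b) *ᶻ T b c z)
             .{{_ : ℤ.NonZero (+ order *ᶻ μ 𝟘)}} where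

      -- A nonzero x lies in r⁻¹K for exactly `size` values of r; at 0 the factor S vanishes.
      S-*-size : ∀ x → S x *ᶻ size ≡ S x *ᶻ ∑ (λ r → κ (r ⊗ x))
      S-*-size x with x ≟ 𝟘
      ... | yes refl rewrite S-𝟘 = refl
      ... | no x≢0 = cong (S x *ᶻ_) (trans (sym (∑-scale x≢0 κ))
                       (∑-cong′ (λ r → cong κ (R.*-comm x r))))

      κ-quotient : ∀ b r → κ (b ⊗ inv r) ≡ 1ℤ → ∀ x → κ (r ⊗ x) ≡ κ (b ⊗ x)
      κ-quotient b r eq x = begin
        κ (r ⊗ x)                     ≡⟨ κ-⊗ eq (r ⊗ x) ⟨
        κ (b ⊗ inv r ⊗ (r ⊗ x))       ≡⟨ cong κ (R.*-assoc b (inv r) _) ⟩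
        κ (b ⊗ (inv r ⊗ (r ⊗ x)))     ≡⟨ cong (λ t → κ (b ⊗ t)) (inv-⊗-cancel r≢0 x) ⟩
        κ (b ⊗ x)                     ∎
        where
        r≢0 : r ≢ 𝟘
        r≢0 refl = κ≡1⇒≢𝟘 eq (trans (cong (b ⊗_) inv-𝟘) (R.zeroʳ b))

      ∑-κ-quotient : ∀ b z → ∑ (λ r → κ (b ⊗ inv r)) *ᶻ T b b z ≡ size *ᶻ T b b z
      ∑-κ-quotient b z with b ≟ 𝟘
      ... | yes refl rewrite T-𝟘ˡ 𝟘 z = trans (ℤ.*-zeroʳ (∑ (λ r → κ (𝟘 ⊗ inv r)))) (sym (ℤ.*-zeroʳ size))
      ... | no b≢0 = cong (_*ᶻ T b b z) (trans (∑-inv (λ r → κ (b ⊗ r))) (∑-scale b≢0 κ))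

      -- Cover the nonzero x by the sets r⁻¹K, each x being counted `size` times. By `orthogonal`
      -- only r in bK contributes, and then r⁻¹K = b⁻¹K.
      localise : ∀ b z → ∑ (λ x → S x *ᶻ μ (b ⊗ x ⊕ z)) ≡ T b b z
      localise b z = ℤ.*-cancelˡ-≡ size _ _ (begin
        size *ᶻ ∑ (λ x → S x *ᶻ μ (b ⊗ x ⊕ z))     ≡⟨ ∑-*ˡ elems size _ ⟨
        ∑ (λ x → size *ᶻ (S x *ᶻ μ (b ⊗ x ⊕ z)))   ≡⟨ ∑-cong′ spread ⟩
        ∑ (λ x → ∑ (λ r → S x *ᶻ (κ (r ⊗ x) *ᶻ μ (b ⊗ x ⊕ z)))) ≡⟨ ∑-swap elems elems _ ⟩
        ∑ (λ r → T r b z)                          ≡⟨ ∑-cong′ (λ r → orthogonal r b z) ⟩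
        ∑ (λ r → κ (b ⊗ inv r) *ᶻ T r b z)         ≡⟨ ∑-cong′ (λ r → κ-*-cong (b ⊗ inv r) (same-T r)) ⟩
        ∑ (λ r → κ (b ⊗ inv r) *ᶻ T b b z)         ≡⟨ ∑-*ʳ elems (T b b z) _ ⟩
        ∑ (λ r → κ (b ⊗ inv r)) *ᶻ T b b z         ≡⟨ ∑-κ-quotient b z ⟩
        size *ᶻ T b b z                            ∎)
        where
        rearrange : ∀ n s m → n *ᶻ (s *ᶻ m) ≡ s *ᶻ n *ᶻ m
        rearrange = solve-∀
        spread : ∀ x → size *ᶻ (S x *ᶻ μ (b ⊗ x ⊕ z)) ≡
                       ∑ (λ r → S x *ᶻ (κ (r ⊗ x) *ᶻ μ (b ⊗ x ⊕ z)))
        spread x = begin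
          size *ᶻ (S x *ᶻ m)                     ≡⟨ rearrange size (S x) m ⟩
          S x *ᶻ size *ᶻ m                       ≡⟨ cong (_*ᶻ m) (S-*-size x) ⟩
          S x *ᶻ ∑ (λ r → κ (r ⊗ x)) *ᶻ m        ≡⟨ ℤ.*-assoc (S x) _ m ⟩
          S x *ᶻ (∑ (λ r → κ (r ⊗ x)) *ᶻ m)      ≡⟨ cong (S x *ᶻ_) (∑-*ʳ elems m _) ⟨
          S x *ᶻ ∑ (λ r → κ (r ⊗ x) *ᶻ m)        ≡⟨ ∑-*ˡ elems (S x) _ ⟨
          ∑ (λ r → S x *ᶻ (κ (r ⊗ x) *ᶻ m))      ∎
          where m = μ (b ⊗ x ⊕ z)
        same-T : ∀ r → κ (b ⊗ inv r) ≡ 1ℤ → T r b z ≡ T b b z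
        same-T r eq = ∑-cong′ (λ x → cong (λ t → S x *ᶻ (t *ᶻ μ (b ⊗ x ⊕ z))) (κ-quotient b r eq x))

      E : 𝔽 → 𝔽 → ℤ
      E b z = ∑ λ x → ∑ λ y → S x *ᶻ (S y *ᶻ μ (b ⊗ y ⊕ (b ⊗ x ⊕ z)))

      -- Both variables range over b⁻¹K while the frequency c is independent of b. `E` only involves
      -- c = b; the freedom in c makes it possible to sum over all frequencies.
      E′ : 𝔽 → 𝔽 → 𝔽 → ℤ
      E′ b c z = ∑ λ x → S x *ᶻ (κ (b ⊗ x) *ᶻ T b c (c ⊗ x ⊕ z))

      ⊕-swap : ∀ x y z → x ⊕ (y ⊕ z) ≡ y ⊕ (x ⊕ z)
      ⊕-swap x y z = trans (sym (R.+-assoc x y z)) (trans (cong (_⊕ z) (R.+-comm x y)) (R.+-assoc y x z))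

      -- `localise` is used twice, for y with x fixed and, after exchanging the sums, for x with y
      -- fixed.
      E≡E′ : ∀ b z → E b z ≡ E′ b b z
      E≡E′ b z = begin
        ∑ (λ x → ∑ (λ y → S x *ᶻ (S y *ᶻ m y x)))
          ≡⟨ ∑-cong′ (λ x → trans (∑-*ˡ elems (S x) _) (trans (cong (S x *ᶻ_) (localise b _)) (sym (∑-*ˡ elems (S x) _)))) ⟩
        ∑ (λ x → ∑ (λ y → S x *ᶻ (S y *ᶻ (κ (b ⊗ y) *ᶻ m y x)))) ≡⟨ ∑-swap elems elems _ ⟩
        ∑ (λ y → ∑ (λ x → S x *ᶻ (S y *ᶻ (κ (b ⊗ y) *ᶻ m y x))))
          ≡⟨ ∑-cong′ (λ y → ∑-cong′ (λ x → trans (rearrange (S x) (S y) (κ (b ⊗ y)) (m y x))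
               (cong (λ t → S y *ᶻ (κ (b ⊗ y) *ᶻ (S x *ᶻ μ t))) (⊕-swap _ _ z)))) ⟩
        ∑ (λ y → ∑ (λ x → S y *ᶻ (κ (b ⊗ y) *ᶻ (S x *ᶻ m x y))))
          ≡⟨ ∑-cong′ (λ y → trans (∑-*ˡ elems (S y) _) (cong (S y *ᶻ_)
               (trans (∑-*ˡ elems (κ (b ⊗ y)) _) (cong (κ (b ⊗ y) *ᶻ_) (localise b _))))) ⟩
        E′ b b z ∎
        where
        m : 𝔽 → 𝔽 → ℤ
        m y x = μ (b ⊗ y ⊕ (b ⊗ x ⊕ z))
        rearrange : ∀ s t k m → s *ᶻ (t *ᶻ (k *ᶻ m)) ≡ t *ᶻ (k *ᶻ (s *ᶻ m))
        rearrange = solve-∀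

      E′-orthogonal : ∀ b c z → E′ b c z ≡ κ (c ⊗ inv b) *ᶻ E′ b c z
      E′-orthogonal b c z = begin
        E′ b c z ≡⟨ ∑-cong′ (λ x → trans (cong (λ t → S x *ᶻ (κ (b ⊗ x) *ᶻ t)) (orthogonal b c _))
                       (rearrange (S x) (κ (b ⊗ x)) (κ (c ⊗ inv b)) _)) ⟩
        ∑ (λ x → κ (c ⊗ inv b) *ᶻ (S x *ᶻ (κ (b ⊗ x) *ᶻ T b c (c ⊗ x ⊕ z)))) ≡⟨ ∑-*ˡ elems (κ (c ⊗ inv b)) _ ⟩
        κ (c ⊗ inv b) *ᶻ E′ b c z ∎
        where
        rearrange : ∀ s k l t → s *ᶻ (k *ᶻ (l *ᶻ t)) ≡ l *ᶻ (s *ᶻ (k *ᶻ t))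
        rearrange = solve-∀

      E′-𝟘 : ∀ c z → E′ 𝟘 c z ≡ 0ℤ
      E′-𝟘 c z = trans (E′-orthogonal 𝟘 c z)
        (cong (_*ᶻ E′ 𝟘 c z) (trans (cong κ (trans (cong (c ⊗_) inv-𝟘) (R.zeroʳ c))) κ-𝟘))

      E′-congˡ : ∀ {b b′} c z → (∀ x → κ (b ⊗ x) ≡ κ (b′ ⊗ x)) → E′ b c z ≡ E′ b′ c z
      E′-congˡ {b} {b′} c z eq = ∑-cong′ λ x → cong₂ (λ k t → S x *ᶻ (k *ᶻ t)) (eq x)
        (∑-cong′ λ y → cong (λ k → S y *ᶻ (k *ᶻ μ (c ⊗ y ⊕ (c ⊗ x ⊕ z)))) (eq y))

      -- By `∑-μ` only the pairs with y = -x survive, and S(x)S(-x) = -1 for x ≠ 0, which is the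
      -- origin of the minus sign.
      ∑-E′ : ∀ b z → ∑ (λ c → E′ b c z) ≡ -ᶻ (∑ (λ x → κ (b ⊗ x)) *ᶻ (+ order *ᶻ μ z))
      ∑-E′ b z = begin
        ∑ (λ c → E′ b c z)
          ≡⟨ ∑-swap elems elems _ ⟩
        ∑ (λ x → ∑ (λ c → S x *ᶻ (κ (b ⊗ x) *ᶻ T b c (c ⊗ x ⊕ z))))
          ≡⟨ ∑-cong′ (λ x → trans (∑-*ˡ elems (S x) _) (cong (S x *ᶻ_) (trans (∑-*ˡ elems (κ (b ⊗ x)) _) (cong (κ (b ⊗ x) *ᶻ_) (diagonal x))))) ⟩
        ∑ (λ x → S x *ᶻ (κ (b ⊗ x) *ᶻ (S (⊖ x) *ᶻ (κ (b ⊗ ⊖ x) *ᶻ (+ order *ᶻ μ z)))))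
          ≡⟨ ∑-cong′ collapse ⟩
        ∑ (λ x → -ᶻ (κ (b ⊗ x) *ᶻ (+ order *ᶻ μ z)))
          ≡⟨ ∑-neg elems _ ⟩
        -ᶻ ∑ (λ x → κ (b ⊗ x) *ᶻ (+ order *ᶻ μ z))
          ≡⟨ cong -ᶻ_ (∑-*ʳ elems _ _) ⟩
        -ᶻ (∑ (λ x → κ (b ⊗ x)) *ᶻ (+ order *ᶻ μ z)) ∎
        where
        v = + order *ᶻ μ z
        rearrange : ∀ s k d v → s *ᶻ (k *ᶻ (d *ᶻ v)) ≡ d *ᶻ (s *ᶻ (k *ᶻ v))
        rearrange = solve-∀
        factor : ∀ c x y → c ⊗ y ⊕ (c ⊗ x ⊕ z) ≡ c ⊗ (x ⊕ y) ⊕ z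
        factor c x y = solve 4 (λ c x y z → c :* y :+ (c :* x :+ z) := c :* (x :+ y) :+ z) refl c x y z
        δ-sum : ∀ x y → δ 𝟘 (x ⊕ y) ≡ δ (⊖ x) y
        δ-sum x y = indicator-⇔ (𝟘 ≟ x ⊕ y) (⊖ x ≟ y)
          (λ eq → sym (+-inverseʳ-unique x y (sym eq)))
          (λ { refl → sym (R.-‿inverseʳ x) })
        diagonal : ∀ x → ∑ (λ c → T b c (c ⊗ x ⊕ z)) ≡ S (⊖ x) *ᶻ (κ (b ⊗ ⊖ x) *ᶻ v)
        diagonal x = begin
          ∑ (λ c → T b c (c ⊗ x ⊕ z)) ≡⟨ ∑-swap elems elems _ ⟩
          ∑ (λ y → ∑ (λ c → S y *ᶻ (κ (b ⊗ y) *ᶻ μ (c ⊗ y ⊕ (c ⊗ x ⊕ z)))))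
            ≡⟨ ∑-cong′ (λ y → trans (∑-*ˡ elems (S y) _) (cong (S y *ᶻ_) (trans (∑-*ˡ elems (κ (b ⊗ y)) _)
                 (cong (κ (b ⊗ y) *ᶻ_) (trans (∑-cong′ (λ c → cong μ (factor c x y)))
                   (trans (∑-μ (x ⊕ y) z) (cong (_*ᶻ v) (δ-sum x y)))))))) ⟩
          ∑ (λ y → S y *ᶻ (κ (b ⊗ y) *ᶻ (δ (⊖ x) y *ᶻ v)))
            ≡⟨ ∑-cong′ (λ y → rearrange (S y) (κ (b ⊗ y)) (δ (⊖ x) y) v) ⟩
          ∑ (λ y → δ (⊖ x) y *ᶻ (S y *ᶻ (κ (b ⊗ y) *ᶻ v)))
            ≡⟨ ∑-δ-* (⊖ x) (λ y → S y *ᶻ (κ (b ⊗ y) *ᶻ v)) ⟩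
          S (⊖ x) *ᶻ (κ (b ⊗ ⊖ x) *ᶻ v) ∎
        regroup : ∀ s k v → s *ᶻ (k *ᶻ (-ᶻ s *ᶻ (k *ᶻ v))) ≡ -ᶻ (s *ᶻ s *ᶻ (k *ᶻ k *ᶻ v))
        regroup = solve-∀
        collapse : ∀ x → S x *ᶻ (κ (b ⊗ x) *ᶻ (S (⊖ x) *ᶻ (κ (b ⊗ ⊖ x) *ᶻ v))) ≡ -ᶻ (κ (b ⊗ x) *ᶻ v)
        collapse x = begin
          S x *ᶻ (κ (b ⊗ x) *ᶻ (S (⊖ x) *ᶻ (κ (b ⊗ ⊖ x) *ᶻ v)))
            ≡⟨ cong₂ (λ s k → S x *ᶻ (κ (b ⊗ x) *ᶻ (s *ᶻ (k *ᶻ v)))) (S-odd x)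
                 (trans (cong κ (sym (-‿distribʳ-* b x))) (κ-⊖ (b ⊗ x))) ⟩
          S x *ᶻ (κ (b ⊗ x) *ᶻ (-ᶻ S x *ᶻ (κ (b ⊗ x) *ᶻ v)))  ≡⟨ regroup (S x) (κ (b ⊗ x)) v ⟩
          -ᶻ (S x *ᶻ S x *ᶻ (κ (b ⊗ x) *ᶻ κ (b ⊗ x) *ᶻ v))
            ≡⟨ cong (λ t → -ᶻ (S x *ᶻ S x *ᶻ (t *ᶻ v))) (κ-idempotent (b ⊗ x)) ⟩
          -ᶻ (S x *ᶻ S x *ᶻ (κ (b ⊗ x) *ᶻ v))  ≡⟨ cong -ᶻ_ unit ⟩
          -ᶻ (κ (b ⊗ x) *ᶻ v) ∎
          where
          unit : S x *ᶻ S x *ᶻ (κ (b ⊗ x) *ᶻ v) ≡ κ (b ⊗ x) *ᶻ v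
          unit with x ≟ 𝟘
          ... | yes refl rewrite R.zeroʳ b | κ-𝟘 = ℤ.*-zeroʳ (S 𝟘 *ᶻ S 𝟘)
          ... | no x≢0 rewrite S² x≢0 = ℤ.*-identityˡ _

      module _ {g : 𝔽} (g≢0 : g ≢ 𝟘) where

        -- The argument is g - x instead of x - g so that the two arguments, divided by k, add up to
        -- g. As S is odd, this changes the usual autocorrelation only by a sign.
        P : 𝔽 → ℤ
        P k = ∑ λ x → S (k ⊗ x) *ᶻ S (k ⊗ (g ⊕ ⊖ x))

        vμ : ℤ
        vμ = + order *ᶻ μ 𝟘

        -- The condition y = g - x is detected by summing μ(kb(x + y - g)) over b, which gives `vμ`
        -- if it holds and 0 otherwise.
        inversion : ∀ {k} → k ≢ 𝟘 → P k *ᶻ vμ ≡ ∑ λ b → E b (⊖ (k ⊗ b ⊗ g))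
        inversion {k} k≢0 = begin
          P k *ᶻ vμ ≡⟨ ∑-*ʳ elems vμ _ ⟨
          ∑ (λ x → S (k ⊗ x) *ᶻ S (k ⊗ (g ⊕ ⊖ x)) *ᶻ vμ) ≡⟨ ∑-cong′ expand ⟩
          ∑ (λ x → ∑ λ y → H (k ⊗ x) (k ⊗ y)) ≡⟨ ∑-cong′ (λ x → ∑-scale k≢0 (H (k ⊗ x))) ⟩
          ∑ (λ x → ∑ λ y → H (k ⊗ x) y) ≡⟨ ∑-scale k≢0 (λ x → ∑ (H x)) ⟩
          ∑ (λ x → ∑ λ y → H x y)
            ≡⟨ ∑-cong′ (λ x → ∑-cong′ (λ y → sym (trans (∑-*ˡ elems (S x) _) (cong (S x *ᶻ_) (∑-*ˡ elems (S y) _))))) ⟩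
          ∑ (λ x → ∑ λ y → ∑ λ b → S x *ᶻ (S y *ᶻ μ (b ⊗ y ⊕ (b ⊗ x ⊕ ⊖ (k ⊗ b ⊗ g)))))
            ≡⟨ ∑-cong′ (λ x → ∑-swap elems elems _) ⟩
          ∑ (λ x → ∑ λ b → ∑ λ y → S x *ᶻ (S y *ᶻ μ (b ⊗ y ⊕ (b ⊗ x ⊕ ⊖ (k ⊗ b ⊗ g)))))
            ≡⟨ ∑-swap elems elems _ ⟩
          ∑ (λ b → E b (⊖ (k ⊗ b ⊗ g))) ∎
          where
          m : 𝔽 → 𝔽 → ℤ
          m x y = ∑ λ b → μ (b ⊗ y ⊕ (b ⊗ x ⊕ ⊖ (k ⊗ b ⊗ g)))
          H : 𝔽 → 𝔽 → ℤ
          H x y = S x *ᶻ (S y *ᶻ m x y)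
          δ-sum : ∀ x y → δ 𝟘 (y ⊕ x ⊕ ⊖ g) ≡ δ (g ⊕ ⊖ x) y
          δ-sum x y = indicator-⇔ (𝟘 ≟ y ⊕ x ⊕ ⊖ g) (g ⊕ ⊖ x ≟ y)
            (λ eq → trans (cong (_⊕ ⊖ x) (trans (sym (R.+-identityˡ g)) (trans (cong (_⊕ g) eq) (⊖-⊕-cancel _ g)))) (⊕-⊖-cancel y x))
            (λ { refl → sym (trans (cong (_⊕ ⊖ g) (⊖-⊕-cancel g x)) (R.-‿inverseʳ g)) })
          factor : ∀ b x y → b ⊗ (k ⊗ y) ⊕ (b ⊗ (k ⊗ x) ⊕ ⊖ (k ⊗ b ⊗ g)) ≡ k ⊗ b ⊗ (y ⊕ x ⊕ ⊖ g) ⊕ 𝟘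
          factor b x y = trans (cong (λ t → b ⊗ (k ⊗ y) ⊕ (b ⊗ (k ⊗ x) ⊕ t)) (-‿distribʳ-* (k ⊗ b) g))
            (trans (solve 5 (λ b k x y g → b :* (k :* y) :+ (b :* (k :* x) :+ (k :* b) :* g) := (k :* b) :* (y :+ x :+ g)) refl b k x y (⊖ g))
              (sym (R.+-identityʳ _)))
          m-scaled : ∀ x y → m (k ⊗ x) (k ⊗ y) ≡ δ (g ⊕ ⊖ x) y *ᶻ vμ
          m-scaled x y = begin
            m (k ⊗ x) (k ⊗ y)                            ≡⟨ ∑-cong′ (λ b → cong μ (factor b x y)) ⟩
            ∑ (λ b → μ (k ⊗ b ⊗ (y ⊕ x ⊕ ⊖ g) ⊕ 𝟘))     ≡⟨ ∑-scale k≢0 (λ b → μ (b ⊗ (y ⊕ x ⊕ ⊖ g) ⊕ 𝟘)) ⟩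
            ∑ (λ b → μ (b ⊗ (y ⊕ x ⊕ ⊖ g) ⊕ 𝟘))         ≡⟨ ∑-μ (y ⊕ x ⊕ ⊖ g) 𝟘 ⟩
            δ 𝟘 (y ⊕ x ⊕ ⊖ g) *ᶻ vμ                      ≡⟨ cong (_*ᶻ vμ) (δ-sum x y) ⟩
            δ (g ⊕ ⊖ x) y *ᶻ vμ                          ∎
          rearrange : ∀ s t d v → s *ᶻ (t *ᶻ (d *ᶻ v)) ≡ d *ᶻ (s *ᶻ t *ᶻ v)
          rearrange = solve-∀
          expand : ∀ x → S (k ⊗ x) *ᶻ S (k ⊗ (g ⊕ ⊖ x)) *ᶻ vμ ≡ ∑ λ y → H (k ⊗ x) (k ⊗ y)
          expand x = sym (trans
            (∑-cong′ λ y → trans (cong (λ t → S (k ⊗ x) *ᶻ (S (k ⊗ y) *ᶻ t)) (m-scaled x y)) (rearrange (S (k ⊗ x)) (S (k ⊗ y)) (δ (g ⊕ ⊖ x) y) vμ))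
            (∑-δ-* (g ⊕ ⊖ x) (λ y → S (k ⊗ x) *ᶻ S (k ⊗ y) *ᶻ vμ)))

        -- For k in K the elements b and kb define the same coset. Substituting k⁻¹b for b therefore
        -- moves k out of the translation and into the frequency alone.
        reparametrise : ∀ {k} → κ k ≡ 1ℤ →
          ∑ (λ b → E b (⊖ (k ⊗ b ⊗ g))) ≡ ∑ (λ b → E′ b (inv k ⊗ b) (⊖ (b ⊗ g)))
        reparametrise {k} κk≡1 = begin
          ∑ (λ b → E b (⊖ (k ⊗ b ⊗ g)))
            ≡⟨ ∑-cong′ (λ b → trans (E≡E′ b _) (trans
                 (E′-congˡ b _ (λ x → trans (sym (κ-⊗ κk≡1 (b ⊗ x))) (cong κ (sym (R.*-assoc k b x)))))
                 (cong (λ t → E′ (k ⊗ b) t (⊖ (k ⊗ b ⊗ g))) (sym (inv-⊗-cancel (κ≡1⇒≢𝟘 κk≡1) b))))) ⟩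
          ∑ (λ b → E′ (k ⊗ b) (inv k ⊗ (k ⊗ b)) (⊖ (k ⊗ b ⊗ g)))
            ≡⟨ ∑-scale (κ≡1⇒≢𝟘 κk≡1) (λ b → E′ b (inv k ⊗ b) (⊖ (b ⊗ g))) ⟩
          ∑ (λ b → E′ b (inv k ⊗ b) (⊖ (b ⊗ g))) ∎

        -- The products kb with k in K fill bK, and `E′` vanishes at all other frequencies.
        ∑-κ-E′ : ∀ b z → ∑ (λ k → κ k *ᶻ E′ b (k ⊗ b) z) ≡ ∑ (λ c → E′ b c z)
        ∑-κ-E′ b z with b ≟ 𝟘
        ... | yes refl = ∑-cong′ λ k → trans (cong (κ k *ᶻ_) (E′-𝟘 _ z)) (trans (ℤ.*-zeroʳ (κ k)) (sym (E′-𝟘 k z)))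
        ... | no b≢0 = begin
          ∑ (λ k → κ k *ᶻ E′ b (k ⊗ b) z)
            ≡⟨ ∑-cong′ (λ k → cong₂ (λ s t → κ s *ᶻ E′ b t z) (sym (cancel k)) (R.*-comm k b)) ⟩
          ∑ (λ k → κ (b ⊗ k ⊗ inv b) *ᶻ E′ b (b ⊗ k) z)
            ≡⟨ ∑-scale b≢0 (λ c → κ (c ⊗ inv b) *ᶻ E′ b c z) ⟩
          ∑ (λ c → κ (c ⊗ inv b) *ᶻ E′ b c z)
            ≡⟨ ∑-cong′ (λ c → E′-orthogonal b c z) ⟨
          ∑ (λ c → E′ b c z) ∎
          where
          cancel : ∀ k → b ⊗ k ⊗ inv b ≡ k
          cancel k = trans (R.*-comm (b ⊗ k) (inv b)) (inv-⊗-cancel b≢0 k)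

        ∑-κ-scale : ∀ b → ∑ (λ x → κ (b ⊗ x)) ≡ (1ℤ -ᶻ δ 𝟘 b) *ᶻ size
        ∑-κ-scale b with 𝟘 ≟ b
        ... | yes refl = trans (∑-cong′ (λ x → trans (cong κ (R.zeroˡ x)) κ-𝟘)) (∑-zero elems)
        ... | no 0≢b = trans (∑-scale (0≢b ∘ sym) κ) (sym (ℤ.*-identityˡ size))

        -- Once all frequencies occur, `∑-E′` leaves minus `size` times `order` times the sum of
        -- μ(-bg) over b ≠ 0. Since μ has total 0, that sum is -μ(0).
        correlation-sum : ∑ (λ k → κ k *ᶻ P k) ≡ size
        correlation-sum = ℤ.*-cancelʳ-≡ _ _ vμ (begin
          ∑ (λ k → κ k *ᶻ P k) *ᶻ vμ            ≡⟨ ∑-*ʳ elems vμ _ ⟨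
          ∑ (λ k → κ k *ᶻ P k *ᶻ vμ)            ≡⟨ ∑-cong′ (λ k → trans (ℤ.*-assoc (κ k) (P k) vμ)
               (κ-*-cong k (λ eq → trans (inversion (κ≡1⇒≢𝟘 eq)) (reparametrise eq)))) ⟩
          ∑ (λ k → κ k *ᶻ ∑ (λ b → E′ b (inv k ⊗ b) (⊖ (b ⊗ g))))
            ≡⟨ ∑-cong′ (λ k → trans (cong (_*ᶻ ∑ (λ b → E′ b (inv k ⊗ b) (⊖ (b ⊗ g)))) (sym (κ-inv k))) (sym (∑-*ˡ elems (κ (inv k)) _))) ⟩
          ∑ (λ k → ∑ (λ b → κ (inv k) *ᶻ E′ b (inv k ⊗ b) (⊖ (b ⊗ g))))
            ≡⟨ ∑-swap elems elems _ ⟩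
          ∑ (λ b → ∑ (λ k → κ (inv k) *ᶻ E′ b (inv k ⊗ b) (⊖ (b ⊗ g))))
            ≡⟨ ∑-cong′ (λ b → trans (∑-inv (λ k → κ k *ᶻ E′ b (k ⊗ b) (⊖ (b ⊗ g)))) (∑-κ-E′ b _)) ⟩
          ∑ (λ b → ∑ (λ c → E′ b c (⊖ (b ⊗ g))))
            ≡⟨ ∑-cong′ (λ b → trans (∑-E′ b _) (trans
                 (cong (λ t → -ᶻ (t *ᶻ (+ order *ᶻ m b))) (∑-κ-scale b))
                 (rearrange (δ 𝟘 b) size (+ order) (m b)))) ⟩
          ∑ (λ b → size *ᶻ + order *ᶻ (δ 𝟘 b *ᶻ m b +ᶻ -ᶻ m b))
            ≡⟨ ∑-*ˡ elems (size *ᶻ + order) _ ⟩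
          size *ᶻ + order *ᶻ ∑ (λ b → δ 𝟘 b *ᶻ m b +ᶻ -ᶻ m b)
            ≡⟨ cong (size *ᶻ + order *ᶻ_) (trans (∑-+ elems _ _) (cong₂ _+ᶻ_ (∑-δ-* 𝟘 m) (trans (∑-neg elems m) (cong -ᶻ_ ∑m≡0)))) ⟩
          size *ᶻ + order *ᶻ (m 𝟘 +ᶻ 0ℤ)
            ≡⟨ cong (size *ᶻ + order *ᶻ_) (trans (ℤ.+-identityʳ (m 𝟘)) (cong μ (trans (cong ⊖_ (R.zeroˡ g)) -0#≈0#))) ⟩
          size *ᶻ + order *ᶻ μ 𝟘 ≡⟨ ℤ.*-assoc size (+ order) (μ 𝟘) ⟩
          size *ᶻ vμ ∎)
          where
          m : 𝔽 → ℤ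
          m b = μ (⊖ (b ⊗ g))
          rearrange : ∀ d n v m → -ᶻ ((1ℤ -ᶻ d) *ᶻ n *ᶻ (v *ᶻ m)) ≡ n *ᶻ v *ᶻ (d *ᶻ m +ᶻ -ᶻ m)
          rearrange = solve-∀
          ∑m≡0 : ∑ m ≡ 0ℤ
          ∑m≡0 = begin
            ∑ (λ b → μ (⊖ (b ⊗ g))) ≡⟨ ∑-cong′ (λ b → cong (λ t → μ (⊖ t)) (R.*-comm b g)) ⟩
            ∑ (λ b → μ (⊖ (g ⊗ b))) ≡⟨ ∑-scale g≢0 (μ ∘ ⊖_) ⟩
            ∑ (μ ∘ ⊖_)              ≡⟨ ∑-⊖ μ ⟩
            ∑ μ                     ≡⟨ ∑μ≡0 ⟩
            0ℤ                      ∎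

  -- The order of a primitive element and discrete logarithms

  module PrimitiveElement (ω : 𝔽) (ω-primitive : IsPrimitive F ω)
                          {n : ℕ} (order≡1+n : order ≡ suc n) (n>1 : 1 < n) where

    -- A count in ℤ: `δ 𝟘 x +ᶻ weight x` is at least 1 everywhere, and its sum over the field is 1 +
    -- d.
    powers-cover⇒n≤ : ∀ d → (∀ x → x ≢ 𝟘 → ∃[ i ] (i < d × x ≡ ω ↑ i)) → n ≤ d
    powers-cover⇒n≤ d cover = s≤s⁻¹ (subst (_≤ suc d) order≡1+n (ℤ.drop‿+≤+ bound))
      where
      weight : 𝔽 → ℤ
      weight x = ∑[ upTo d ] (λ i → δ (ω ↑ i) x)
      δ-nonneg : ∀ a x → 0ℤ ℤ.≤ δ a x
      δ-nonneg a x = indicator-nonneg (a ≟ x)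
      weight-nonneg : ∀ x → 0ℤ ℤ.≤ weight x
      weight-nonneg x = ℤ.≤-trans (ℤ.≤-reflexive (sym (∑-zero (upTo d)))) (∑-mono (upTo d) (λ i → δ-nonneg (ω ↑ i) x))
      covered : ∀ x → 1ℤ ℤ.≤ δ 𝟘 x +ᶻ weight x
      covered x with 𝟘 ≟ x
      ... | yes refl = ℤ.+-monoʳ-≤ 1ℤ (weight-nonneg 𝟘)
      ... | no 0≢x with i , i<d , refl ← cover x (0≢x ∘ sym) =
        ℤ.≤-trans (ℤ.≤-reflexive (sym (δ-refl (ω ↑ i))))
          (ℤ.≤-trans (∑-∈ (λ j → δ-nonneg (ω ↑ j) (ω ↑ i)) (∈-upTo⁺ i<d)) (ℤ.≤-reflexive (sym (ℤ.+-identityˡ _))))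
      bound : + order ℤ.≤ + suc d
      bound = begin
        + order                            ≡⟨ ℤ.*-identityʳ _ ⟨
        + order *ᶻ 1ℤ                      ≡⟨ ∑-const elems 1ℤ ⟨
        ∑ (λ _ → 1ℤ)                       ≤⟨ ∑-mono elems covered ⟩
        ∑ (λ x → δ 𝟘 x +ᶻ weight x)        ≡⟨ ∑-+ elems (δ 𝟘) weight ⟩
        ∑ (δ 𝟘) +ᶻ ∑ weight                ≡⟨ cong₂ _+ᶻ_ (∑-δ 𝟘) (∑-swap elems (upTo d) _) ⟩
        1ℤ +ᶻ ∑[ upTo d ] (λ i → ∑ (δ (ω ↑ i))) ≡⟨ cong (1ℤ +ᶻ_) (∑-cong (upTo d) (λ i → ∑-δ (ω ↑ i))) ⟩
        1ℤ +ᶻ ∑[ upTo d ] (λ _ → 1ℤ)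
          ≡⟨ cong (1ℤ +ᶻ_) (trans (∑-const (upTo d) 1ℤ) (ℤ.*-identityʳ (+ length (upTo d)))) ⟩
        1ℤ +ᶻ + length (upTo d)  ≡⟨ cong (λ l → 1ℤ +ᶻ + l) (length-upTo d) ⟩
        + suc d                            ∎
        where open ℤ.≤-Reasoning

    -- `IsPrimitive` admits ω = 0 in the field of two elements, where `𝟙` is the zeroth power; `n>1`
    -- excludes that case.
    ω≢𝟘 : ω ≢ 𝟘
    ω≢𝟘 refl = ℕ.<⇒≱ n>1 (powers-cover⇒n≤ 1 λ x x≢0 → case x≢0 (ω-primitive x x≢0))
      where
      case : ∀ {x} → x ≢ 𝟘 → ∃[ e ] x ≡ 𝟘 ↑ e → ∃[ i ] (i < 1 × x ≡ 𝟘 ↑ i)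
      case x≢0 (zero , eq)  = 0 , z<s , eq
      case x≢0 (suc e , eq) = contradiction (trans eq (R.zeroˡ _)) x≢0

    ω↑≢𝟘 : ∀ e → ω ↑ e ≢ 𝟘
    ω↑≢𝟘 e = ↑-≢𝟘 e ω≢𝟘

    ω↑-∸ : ∀ {a b} → a ≤ b → ω ↑ a ≡ ω ↑ b → ω ↑ (b ∸ a) ≡ 𝟙
    ω↑-∸ {a} {b} a≤b eq = ⊗-cancelˡ (ω↑≢𝟘 a) (begin
      ω ↑ a ⊗ ω ↑ (b ∸ a)  ≡⟨ ↑-+ ω a (b ∸ a) ⟨
      ω ↑ (a + (b ∸ a))    ≡⟨ cong (ω ↑_) (ℕ.m+[n∸m]≡n a≤b) ⟩
      ω ↑ b                ≡⟨ eq ⟨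
      ω ↑ a                ≡⟨ R.*-identityʳ _ ⟨
      ω ↑ a ⊗ 𝟙            ∎)
      where open ≡-Reasoning

    ω↑-% : ∀ d .{{_ : NonZero d}} → ω ↑ d ≡ 𝟙 → ∀ e → ω ↑ e ≡ ω ↑ (e % d)
    ω↑-% d ω↑d≡𝟙 e = begin
      ω ↑ e                            ≡⟨ cong (ω ↑_) (m≡m%n+[m/n]*n e d) ⟩
      ω ↑ (e % d + e / d * d)          ≡⟨ ↑-+ ω (e % d) _ ⟩
      ω ↑ (e % d) ⊗ ω ↑ (e / d * d)
        ≡⟨ cong (ω ↑ (e % d) ⊗_) (trans (↑-* ω (e / d) d) (trans (cong (_↑ (e / d)) ω↑d≡𝟙) (𝟙↑ (e / d)))) ⟩
      ω ↑ (e % d) ⊗ 𝟙                  ≡⟨ R.*-identityʳ _ ⟩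
      ω ↑ (e % d)                      ∎
      where open ≡-Reasoning

    ω↑≡𝟙⇒n≤ : ∀ d .{{_ : NonZero d}} → ω ↑ d ≡ 𝟙 → n ≤ d
    ω↑≡𝟙⇒n≤ d ω↑d≡𝟙 = powers-cover⇒n≤ d λ x x≢0 →
      let e , x≡ω↑e = ω-primitive x x≢0 in e % d , m%n<n e d , trans x≡ω↑e (ω↑-% d ω↑d≡𝟙 e)

    -- Among 0 and the powers with exponents 0, ..., n there is one point more than the field has. A
    -- collision gives ω^d = 1 with 0 < d ≤ n, and d ≥ n because the powers below d cover all
    -- nonzero elements.
    ω↑n≡𝟙 : ω ↑ n ≡ 𝟙
    ω↑n≡𝟙 with Fin.pigeonhole (ℕ.n<1+n order) (position ∘ point)
      where
      point : Fin (suc order) → 𝔽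
      point Fin.zero    = 𝟘
      point (Fin.suc i) = ω ↑ toℕ i
    ... | Fin.zero  , Fin.suc j , _ , eq = contradiction (sym (position-injective eq)) (ω↑≢𝟘 (toℕ j))
    ... | Fin.suc i , Fin.suc j , s≤s i<j , eq = subst (λ d → ω ↑ d ≡ 𝟙)
      (ℕ.≤-antisym d≤n (ω↑≡𝟙⇒n≤ d {{>-nonZero (ℕ.m<n⇒0<n∸m i<j)}} ω↑d≡𝟙)) ω↑d≡𝟙
      where
      d = toℕ j ∸ toℕ i
      ω↑d≡𝟙 = ω↑-∸ (ℕ.<⇒≤ i<j) (position-injective eq)
      d≤n : d ≤ n
      d≤n = ℕ.≤-trans (ℕ.m∸n≤m (toℕ j) (toℕ i)) (s≤s⁻¹ (subst (toℕ j <_) order≡1+n (Fin.toℕ<n j)))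

    instance
      n-nonZero : NonZero n
      n-nonZero = >-nonZero (ℕ.<-trans z<s n>1)

    ω↑≡𝟙⇒n∣ : ∀ d → ω ↑ d ≡ 𝟙 → n ∣ d
    ω↑≡𝟙⇒n∣ d ω↑d≡𝟙 with d % n in eq
    ... | zero = divides (d / n) (trans (m≡m%n+[m/n]*n d n) (cong (_+ d / n * n) eq))
    ... | suc r = contradiction (ω↑≡𝟙⇒n≤ (suc r) (trans (trans (cong (ω ↑_) (sym eq)) (sym (ω↑-% n ω↑n≡𝟙 d))) ω↑d≡𝟙))
                    (ℕ.<⇒≱ (subst (_< n) eq (m%n<n d n)))

    ω↑-≡ : ∀ {a b} → ω ↑ a ≡ ω ↑ b → ∃[ c ] (a ≡ c * n + b ⊎ b ≡ c * n + a)
    ω↑-≡ {a} {b} eq with ℕ.≤-total a b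
    ... | inj₁ a≤b with divides c b∸a≡cn ← ω↑≡𝟙⇒n∣ (b ∸ a) (ω↑-∸ a≤b eq) =
      c , inj₂ (trans (sym (ℕ.m∸n+n≡m a≤b)) (cong (_+ a) b∸a≡cn))
    ... | inj₂ b≤a with divides c a∸b≡cn ← ω↑≡𝟙⇒n∣ (a ∸ b) (ω↑-∸ b≤a (sym eq)) =
      c , inj₁ (trans (sym (ℕ.m∸n+n≡m b≤a)) (cong (_+ b) a∸b≡cn))

    𝔽-by-log : ∀ {P : 𝔽 → Set} → P 𝟘 → (∀ e → P (ω ↑ e)) → ∀ x → P x
    𝔽-by-log p0 p x with x ≟ 𝟘
    ... | yes refl = p0
    ... | no x≢0 with e , refl ← ω-primitive x x≢0 = p e

    -- A function of the discrete logarithm, extended by 0. The exponent supplied by `ω-primitive`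
    -- is arbitrary, so only n-periodic φ give a meaningful result.
    lift : (ℕ → ℤ) → 𝔽 → ℤ
    lift φ x with x ≟ 𝟘
    ... | yes _  = 0ℤ
    ... | no x≢0 = φ (proj₁ (ω-primitive x x≢0))

    lift-𝟘 : ∀ φ → lift φ 𝟘 ≡ 0ℤ
    lift-𝟘 φ with 𝟘 ≟ 𝟘
    ... | yes _  = refl
    ... | no 0≢0 = contradiction refl 0≢0

    lift-↑ : ∀ φ → (∀ c e → φ (c * n + e) ≡ φ e) → ∀ e → lift φ (ω ↑ e) ≡ φ e
    lift-↑ φ periodic e with ω ↑ e ≟ 𝟘
    ... | yes eq = contradiction eq (ω↑≢𝟘 e)
    ... | no ≢0 with e′ , eq ← ω-primitive (ω ↑ e) ≢0 with ω↑-≡ {e} {e′} eq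
    ...   | c , inj₁ e≡ = sym (trans (cong φ e≡) (periodic c e′))
    ...   | c , inj₂ e′≡ = trans (cong φ e′≡) (periodic c e)

  -- The integer-valued substitute for an additive character

  module FrobeniusKernel (q : ℕ) (q-additive : Additive q) where

    open ≡-Reasoning

    -- 1 + μ is a multiple of the indicator function of the image of x ↦ x^q - x, so μ is
    -- invariant under translation by that image; hence μ-frobenius.
    μ : 𝔽 → ℤ
    μ x = ∑ (λ y → δ (y ↑ q ⊕ ⊖ y) x) -ᶻ 1ℤ

    ∑μ≡0 : ∑ μ ≡ 0ℤ
    ∑μ≡0 = begin
      ∑ μ                                                    ≡⟨ ∑-+ elems _ _ ⟩
      ∑ (λ x → ∑ (λ y → δ (y ↑ q ⊕ ⊖ y) x)) +ᶻ ∑ (λ _ → -1ℤ)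
        ≡⟨ cong (_+ᶻ ∑ (λ _ → -1ℤ)) (trans (∑-swap elems elems _) (∑-cong′ (λ y → ∑-δ (y ↑ q ⊕ ⊖ y)))) ⟩
      ∑ (λ _ → 1ℤ) +ᶻ ∑ (λ _ → -1ℤ)                          ≡⟨ ∑-+ elems _ _ ⟨
      ∑ (λ _ → 0ℤ)                                           ≡⟨ ∑-zero elems ⟩
      0ℤ                                                     ∎

    μ-frobenius : ∀ x z → μ (x ↑ q ⊕ z) ≡ μ (x ⊕ z)
    μ-frobenius x z = cong (_-ᶻ 1ℤ) (begin
      ∑ (λ y → δ (y ↑ q ⊕ ⊖ y) (x ↑ q ⊕ z))              ≡⟨ ∑-shift x (λ y → δ (y ↑ q ⊕ ⊖ y) (x ↑ q ⊕ z)) ⟨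
      ∑ (λ y → δ ((y ⊕ x) ↑ q ⊕ ⊖ (y ⊕ x)) (x ↑ q ⊕ z)) ≡⟨ ∑-cong′ translate ⟩
      ∑ (λ y → δ (y ↑ q ⊕ ⊖ y) (x ⊕ z))                  ∎)
      where
      w = x ↑ q ⊕ ⊖ x
      left : ∀ y → (y ⊕ x) ↑ q ⊕ ⊖ (y ⊕ x) ≡ y ↑ q ⊕ ⊖ y ⊕ w
      left y = trans (cong₂ _⊕_ (q-additive y x) (sym (⁻¹-∙-comm y x)))
        (solve 4 (λ a b c d → (a :+ b) :+ (c :+ d) := (a :+ c) :+ (b :+ d)) refl (y ↑ q) (x ↑ q) (⊖ y) (⊖ x))
      right : x ↑ q ⊕ z ≡ x ⊕ z ⊕ w
      right = begin
        x ↑ q ⊕ z                   ≡⟨ ⊖-⊕-cancel (x ↑ q ⊕ z) x ⟨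
        x ↑ q ⊕ z ⊕ ⊖ x ⊕ x
          ≡⟨ solve 4 (λ a b c d → a :+ b :+ c :+ d := d :+ b :+ (a :+ c)) refl (x ↑ q) z (⊖ x) x ⟩
        x ⊕ z ⊕ w                   ∎
      translate : ∀ y → δ ((y ⊕ x) ↑ q ⊕ ⊖ (y ⊕ x)) (x ↑ q ⊕ z) ≡ δ (y ↑ q ⊕ ⊖ y) (x ⊕ z)
      translate y = indicator-⇔ (_ ≟ _) (_ ≟ _)
        (λ eq → +-cancelʳ w _ _ (trans (sym (left y)) (trans eq right)))
        (λ eq → trans (left y) (trans (cong (_⊕ w) eq) (sym right)))

    μ-frobenius^ : ∀ k x z → μ (x ↑ (q ^ k) ⊕ z) ≡ μ (x ⊕ z)
    μ-frobenius^ zero    x z = cong (λ t → μ (t ⊕ z)) (R.*-identityʳ x)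
    μ-frobenius^ (suc k) x z = begin
      μ (x ↑ (q * q ^ k) ⊕ z)  ≡⟨ cong (λ t → μ (t ⊕ z)) (↑-* x q (q ^ k)) ⟩
      μ (x ↑ (q ^ k) ↑ q ⊕ z)  ≡⟨ μ-frobenius (x ↑ (q ^ k)) z ⟩
      μ (x ↑ (q ^ k) ⊕ z)      ≡⟨ μ-frobenius^ k x z ⟩
      μ (x ⊕ z)                ∎

    module _ .{{_ : NonZero q}} where

      fixed-𝟘 : 𝟘 ↑ q ⊕ ⊖ 𝟘 ≡ 𝟘
      fixed-𝟘 = trans (cong (λ k → 𝟘 ↑ k ⊕ ⊖ 𝟘) (sym (ℕ.suc-pred q)))
        (trans (cong (_⊕ ⊖ 𝟘) (R.zeroˡ _)) (R.-‿inverseʳ 𝟘))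

      fixed-𝟙 : 𝟙 ↑ q ⊕ ⊖ 𝟙 ≡ 𝟘
      fixed-𝟙 = trans (cong (_⊕ ⊖ 𝟙) (𝟙↑ q)) (R.-‿inverseʳ 𝟙)

      -- `𝟘` and `𝟙` are two solutions of y^q = y, against the 1 subtracted in μ. Positivity allows
      -- `vμ` to be cancelled.
      μ-𝟘-positive : 0ℤ ℤ.< μ 𝟘
      μ-𝟘-positive = ℤ.<-≤-trans (ℤ.+<+ z<s) (ℤ.+-monoˡ-≤ -1ℤ two≤)
        where
        fixed-points : ∀ y → δ 𝟘 y +ᶻ δ 𝟙 y ℤ.≤ δ (y ↑ q ⊕ ⊖ y) 𝟘
        fixed-points y with 𝟘 ≟ y | 𝟙 ≟ y
        ... | yes refl | yes 1≡0 = contradiction (sym 1≡0) 0≢1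
        ... | yes refl | no _ = ℤ.≤-reflexive (sym (indicator-yes (_ ≟ _) fixed-𝟘))
        ... | no _ | yes refl = ℤ.≤-reflexive (sym (indicator-yes (_ ≟ _) fixed-𝟙))
        ... | no _ | no _ = indicator-nonneg (_ ≟ _)
        two≤ : + 2 ℤ.≤ ∑ (λ y → δ (y ↑ q ⊕ ⊖ y) 𝟘)
        two≤ = subst (ℤ._≤ ∑ (λ y → δ (y ↑ q ⊕ ⊖ y) 𝟘))
          (trans (∑-+ elems (δ 𝟘) (δ 𝟙)) (cong₂ _+ᶻ_ (∑-δ 𝟘) (∑-δ 𝟙)))
          (∑-mono elems fixed-points)

  -- The sign function S, the subgroup K and the vanishing of T off bK

  module Construction (ω : 𝔽) (ω-primitive : IsPrimitive F ω)
    (w s q m : ℕ) (q≡ : q ≡ suc (4 * 2 ^ w * (1 + 2 * m)))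
    (q-additive : Additive q) (order≡q^2^s : order ≡ q ^ (2 ^ s)) where

    open ≡-Reasoning

    -- In the notation of the theorem u = w + 2, t = u + s, L = 2^(u-1) and H = N/2.
    W L f H : ℕ
    W = 2 ^ w
    L = 2 * W
    f = 2 ^ s
    H = L * f

    instance
      W-nonZero : NonZero W
      W-nonZero = ℕ.m^n≢0 2 w
      f-nonZero : NonZero f
      f-nonZero = ℕ.m^n≢0 2 s
      H-nonZero : NonZero H
      H-nonZero = ℕ.m*n≢0 L f {{ℕ.m*n≢0 2 W}}
      q-nonZero : NonZero q
      q-nonZero = subst NonZero (sym q≡) _

    -- N = 2H divides the order n of the unit group with odd quotient `1 + 2 * o`; hence n/2 is an
    -- odd multiple of H.
    o n : ℕ
    o = proj₁ ([1+4W·odd]^2^ W m q≡ s)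
    n = 4 * W * f * (1 + 2 * o)

    order≡1+n : order ≡ suc n
    order≡1+n = trans order≡q^2^s (proj₂ ([1+4W·odd]^2^ W m q≡ s))

    n>1 : 1 < n
    n>1 = ℕ.≤-trans (s≤s (s≤s z≤n)) (ℕ.≤-trans (ℕ.m≤m*n 4 W) (ℕ.≤-trans (ℕ.m≤m*n (4 * W) f) (ℕ.m≤m*n (4 * W * f) (1 + 2 * o))))

    open PrimitiveElement ω ω-primitive order≡1+n n>1 public
    open FrobeniusKernel q q-additive public

    sg : ℕ → ℤ
    sg e = sign (e / H)

    sg-shift : ∀ a e → sg (a * H + e) ≡ sign a *ᶻ sg e
    sg-shift a e = begin
      sign ((a * H + e) / H)     ≡⟨ cong sign (+-distrib-/-∣ˡ e (n∣m*n a)) ⟩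
      sign (a * H / H + e / H)   ≡⟨ cong (λ k → sign (k + e / H)) (m*n/n≡m a H) ⟩
      sign (a + e / H)           ≡⟨ sign-+ a (e / H) ⟩
      sign a *ᶻ sg e             ∎

    n≡ : n ≡ (2 * (1 + 2 * o)) * H
    n≡ = shape W f o
      where
      shape : ∀ W f o → 4 * W * f * (1 + 2 * o) ≡ (2 * (1 + 2 * o)) * (2 * W * f)
      shape = ℕ-solver.solve-∀

    sg-periodic : ∀ c e → sg (c * n + e) ≡ sg e
    sg-periodic c e = begin
      sg (c * n + e)                           ≡⟨ cong (λ k → sg (c * k + e)) n≡ ⟩
      sg (c * (2 * (1 + 2 * o) * H) + e)       ≡⟨ cong (λ k → sg (k + e)) (shape c (1 + 2 * o) H) ⟩
      sg (2 * (c * (1 + 2 * o)) * H + e)       ≡⟨ sg-shift (2 * (c * (1 + 2 * o))) e ⟩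
      sign (2 * (c * (1 + 2 * o))) *ᶻ sg e     ≡⟨ cong (_*ᶻ sg e) (sign-even (c * (1 + 2 * o))) ⟩
      1ℤ *ᶻ sg e                               ≡⟨ ℤ.*-identityˡ _ ⟩
      sg e                                     ∎
      where
      shape : ∀ c d H → c * (2 * d * H) ≡ 2 * (c * d) * H
      shape = ℕ-solver.solve-∀

    S : 𝔽 → ℤ
    S = lift sg

    S-𝟘 : S 𝟘 ≡ 0ℤ
    S-𝟘 = lift-𝟘 sg

    S-↑ : ∀ e → S (ω ↑ e) ≡ sg e
    S-↑ = lift-↑ sg sg-periodic

    S-shift : ∀ a x → S (ω ↑ (a * H) ⊗ x) ≡ sign a *ᶻ S x
    S-shift a = 𝔽-by-log
      (trans (cong S (R.zeroʳ _)) (trans S-𝟘 (sym (trans (cong (sign a *ᶻ_) S-𝟘) (ℤ.*-zeroʳ (sign a))))))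
      λ e → begin
        S (ω ↑ (a * H) ⊗ ω ↑ e)  ≡⟨ cong S (↑-+ ω (a * H) e) ⟨
        S (ω ↑ (a * H + e))      ≡⟨ S-↑ (a * H + e) ⟩
        sg (a * H + e)           ≡⟨ sg-shift a e ⟩
        sign a *ᶻ sg e           ≡⟨ cong (sign a *ᶻ_) (S-↑ e) ⟨
        sign a *ᶻ S (ω ↑ e)      ∎

    S² : ∀ {x} → x ≢ 𝟘 → S x *ᶻ S x ≡ 1ℤ
    S² {x} = 𝔽-by-log {λ x → x ≢ 𝟘 → S x *ᶻ S x ≡ 1ℤ} (λ 0≢0 → contradiction refl 0≢0)
      (λ e _ → trans (cong (λ i → i *ᶻ i) (S-↑ e)) (sign-square (e / H))) x

    κ-exponent : ℕ → ℤ
    κ-exponent e = indicator (f ∣? e)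

    κ : 𝔽 → ℤ
    κ = lift κ-exponent

    κ-exponent-shift : ∀ {a} e → f ∣ a → κ-exponent (a + e) ≡ κ-exponent e
    κ-exponent-shift {a} e f∣a = indicator-⇔ (f ∣? (a + e)) (f ∣? e) (λ d → ∣m+n∣m⇒∣n d f∣a) (∣m∣n⇒∣m+n f∣a)

    f∣H : f ∣ H
    f∣H = n∣m*n L

    f∣n : f ∣ n
    f∣n = subst (f ∣_) (sym n≡) (∣-trans f∣H (n∣m*n (2 * (1 + 2 * o))))

    κ-𝟘 : κ 𝟘 ≡ 0ℤ
    κ-𝟘 = lift-𝟘 κ-exponent

    κ-↑ : ∀ e → κ (ω ↑ e) ≡ κ-exponent e
    κ-↑ = lift-↑ κ-exponent (λ c e → κ-exponent-shift e (∣-trans f∣n (n∣m*n c)))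

    κ-𝟙 : κ 𝟙 ≡ 1ℤ
    κ-𝟙 = trans (κ-↑ 0) (indicator-yes (f ∣? 0) (divides 0 refl))

    κ-bit : ∀ x → κ x ≡ 0ℤ ⊎ κ x ≡ 1ℤ
    κ-bit = 𝔽-by-log (inj₁ κ-𝟘) λ e → subst (λ k → k ≡ 0ℤ ⊎ k ≡ 1ℤ) (sym (κ-↑ e)) (indicator-bit (f ∣? e))

    κ-shift : ∀ {a} → f ∣ a → ∀ x → κ (ω ↑ a ⊗ x) ≡ κ x
    κ-shift {a} f∣a = 𝔽-by-log (cong κ (R.zeroʳ _)) λ e →
      trans (cong κ (sym (↑-+ ω a e))) (trans (κ-↑ (a + e)) (trans (κ-exponent-shift e f∣a) (sym (κ-↑ e))))

    κ≡1⇒ : ∀ {x} → κ x ≡ 1ℤ → ∃[ a ] x ≡ ω ↑ (a * f)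
    κ≡1⇒ {x} = 𝔽-by-log {λ x → κ x ≡ 1ℤ → ∃[ a ] x ≡ ω ↑ (a * f)}
      (λ κ𝟘≡1 → contradiction (trans (sym κ𝟘≡1) κ-𝟘) λ ()) exponent x
      where
      exponent : ∀ e → κ (ω ↑ e) ≡ 1ℤ → ∃[ a ] ω ↑ e ≡ ω ↑ (a * f)
      exponent e eq = multiple (indicator≡1⇒ (f ∣? e) (trans (sym (κ-↑ e)) eq))
        where
        multiple : f ∣ e → ∃[ a ] ω ↑ e ≡ ω ↑ (a * f)
        multiple (divides a e≡af) = a , cong (ω ↑_) e≡af

    κ-⊗ : ∀ {x} → κ x ≡ 1ℤ → ∀ y → κ (x ⊗ y) ≡ κ y
    κ-⊗ {x} κx≡1 y = trans (cong (λ t → κ (t ⊗ y)) (proj₂ log)) (κ-shift (n∣m*n (proj₁ log)) y)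
      where log = κ≡1⇒ κx≡1

    -- This power y satisfies y² = 1. If y + 1 were nonzero, cancelling it from (y + 1)y = y + 1
    -- would give y = 1, although the exponent is n/2.
    ω↑-half : ω ↑ ((1 + 2 * o) * H) ≡ ⊖ 𝟙
    ω↑-half with y ⊕ 𝟙 ≟ 𝟘
      where y = ω ↑ ((1 + 2 * o) * H)
    ... | yes eq = +-inverseʳ-unique 𝟙 _ (trans (R.+-comm 𝟙 _) eq)
    ... | no y+1≢0 = contradiction (∣⇒≤ {{half-nonZero}} (ω↑≡𝟙⇒n∣ half y≡𝟙)) (ℕ.<⇒≱ half<n)
      where
      half : ℕ
      half = (1 + 2 * o) * H
      y = ω ↑ half
      n≡half+half : n ≡ half + half
      n≡half+half = trans n≡ (shape (1 + 2 * o) H)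
        where
        shape : ∀ c H → 2 * c * H ≡ c * H + c * H
        shape = ℕ-solver.solve-∀
      half-nonZero : NonZero half
      half-nonZero = ℕ.m*n≢0 (1 + 2 * o) H
      half<n : half < n
      half<n = subst (half <_) (sym n≡half+half) (ℕ.m<m+n half (>-nonZero⁻¹ half {{half-nonZero}}))
      y⊗y≡𝟙 : y ⊗ y ≡ 𝟙
      y⊗y≡𝟙 = trans (sym (↑-+ ω half half)) (trans (cong (ω ↑_) (sym n≡half+half)) ω↑n≡𝟙)
      y≡𝟙 : y ≡ 𝟙
      y≡𝟙 = ⊗-cancelˡ y+1≢0 (begin
        (y ⊕ 𝟙) ⊗ y     ≡⟨ R.distribʳ y y 𝟙 ⟩
        y ⊗ y ⊕ 𝟙 ⊗ y   ≡⟨ cong₂ _⊕_ y⊗y≡𝟙 (R.*-identityˡ y) ⟩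
        𝟙 ⊕ y           ≡⟨ R.+-comm 𝟙 y ⟩
        y ⊕ 𝟙           ≡⟨ R.*-identityʳ _ ⟨
        (y ⊕ 𝟙) ⊗ 𝟙     ∎)

    ⊖≡ω↑half⊗ : ∀ x → ⊖ x ≡ ω ↑ ((1 + 2 * o) * H) ⊗ x
    ⊖≡ω↑half⊗ x = trans (sym (-1*x≈-x x)) (cong (_⊗ x) (sym ω↑-half))

    S-odd : ∀ x → S (⊖ x) ≡ -ᶻ S x
    S-odd x = begin
      S (⊖ x)                           ≡⟨ cong S (⊖≡ω↑half⊗ x) ⟩
      S (ω ↑ ((1 + 2 * o) * H) ⊗ x)     ≡⟨ S-shift (1 + 2 * o) x ⟩
      sign (1 + 2 * o) *ᶻ S x           ≡⟨ cong (_*ᶻ S x) (sign-odd o) ⟩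
      -1ℤ *ᶻ S x                        ≡⟨ ℤ.-1*i≡-i (S x) ⟩
      -ᶻ S x                            ∎

    κ-⊖ : ∀ x → κ (⊖ x) ≡ κ x
    κ-⊖ x = trans (cong κ (⊖≡ω↑half⊗ x)) (κ-shift (∣-trans f∣H (n∣m*n (1 + 2 * o))) x)

    open Correlation S κ μ S-odd S² κ-bit κ-𝟘 κ-𝟙 κ-⊖ κ-⊗ ∑μ≡0 public
      hiding (S-𝟘)

    ↑-order : ∀ x → x ↑ order ≡ x
    ↑-order x = trans (cong (x ↑_) order≡1+n) (𝔽-by-log {λ x → x ↑ suc n ≡ x} (R.zeroˡ _) power x)
      where
      power : ∀ e → ω ↑ e ⊗ ω ↑ e ↑ n ≡ ω ↑ e
      power e = trans (cong (ω ↑ e ⊗_) (begin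
        ω ↑ e ↑ n    ≡⟨ ↑-* ω n e ⟨
        ω ↑ (n * e)  ≡⟨ cong (ω ↑_) (ℕ.*-comm n e) ⟩
        ω ↑ (e * n)  ≡⟨ ↑-* ω e n ⟩
        ω ↑ n ↑ e    ≡⟨ trans (cong (_↑ e) ω↑n≡𝟙) (𝟙↑ e) ⟩
        𝟙            ∎)) (R.*-identityʳ _)

    -- The inverse of x ↦ x^q is the power map with exponent q^(f-1), because x^(q^f) = x.
    ∑-frobenius : (g : 𝔽 → ℤ) → ∑ (λ x → g (x ↑ q)) ≡ ∑ g
    ∑-frobenius = ∑-reindex (_↑ q) (_↑ r)
      (λ x → trans (sym (↑-* x r q)) (trans (cong (x ↑_) (trans (ℕ.*-comm r q) (sym order≡qr))) (↑-order x)))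
      (λ x → trans (sym (↑-* x q r)) (trans (cong (x ↑_) (sym order≡qr)) (↑-order x)))
      where
      r = q ^ pred f
      order≡qr : order ≡ q * r
      order≡qr = trans order≡q^2^s (cong (q ^_) (sym (ℕ.suc-pred f)))

    ∑-frobenius^ : ∀ k (g : 𝔽 → ℤ) → ∑ (λ x → g (x ↑ (q ^ k))) ≡ ∑ g
    ∑-frobenius^ zero    g = ∑-cong′ (λ x → cong g (R.*-identityʳ x))
    ∑-frobenius^ (suc k) g = trans (∑-cong′ (λ x → cong g (↑-* x q (q ^ k))))
      (trans (∑-frobenius^ k (λ x → g (x ↑ q))) (∑-frobenius g))

    -- With a = 2^e · odd and s = e + j + 1, the number 2r = q^(2^j) - 1 is 2^(u+j) · odd. So 2ra is
    -- 2^(u+s-1) = H times an odd number, whereas 2rf contains the further factor 2^(j+1).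
    twist : ∀ a → ¬ f ∣ a → ∃[ k ] ∃[ r ] ∃[ A ] ∃[ B ]
      (q ^ k ≡ suc (2 * r) × 2 * r * a ≡ (1 + 2 * A) * H × 2 * r * f ≡ 2 * B * H)
    twist a ∤ with e , j , p , s≡ , refl ← 2^∤-decompose s a ∤
              with o′ , q^≡ ← [1+4W·odd]^2^ W m q≡ j =
      2 ^ j , 2 * W * 2 ^ j * (1 + 2 * o′) , o′ + p + 2 * (o′ * p) , 2 ^ j * (1 + 2 * o′) ,
      trans q^≡ (cong suc (shape₀ W (2 ^ j) o′)) ,
      trans (shape₁ W (2 ^ j) (2 ^ e) o′ p) (cong (λ t → (1 + 2 * (o′ + p + 2 * (o′ * p))) * (2 * W * t)) (sym f≡)) ,
      shape₂ W (2 ^ j) f o′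
      where
      f≡ : f ≡ 2 ^ e * (2 * 2 ^ j)
      f≡ = trans (cong (2 ^_) s≡) (ℕ.^-distribˡ-+-* 2 e (suc j))
      shape₀ : ∀ W J o → 4 * W * J * (1 + 2 * o) ≡ 2 * (2 * W * J * (1 + 2 * o))
      shape₀ = ℕ-solver.solve-∀
      shape₁ : ∀ W J E o p → 2 * (2 * W * J * (1 + 2 * o)) * (E * (1 + 2 * p)) ≡
        (1 + 2 * (o + p + 2 * (o * p))) * (2 * W * (E * (2 * J)))
      shape₁ = ℕ-solver.solve-∀
      shape₂ : ∀ W J f o → 2 * (2 * W * J * (1 + 2 * o)) * f ≡ 2 * (J * (1 + 2 * o)) * (2 * W * f)
      shape₂ = ℕ-solver.solve-∀

    T-vanish : ∀ {b} a z → b ≢ 𝟘 → ¬ f ∣ a → T b (ω ↑ a ⊗ b) z ≡ 0ℤ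
    T-vanish {b} a z b≢0 f∤a with k , r , A , B , q^k≡ , ra≡ , rf≡ ← twist a f∤a = x≡-x⇒x≡0 _ (begin
      ∑ G                                         ≡⟨ ∑-scale (↑-≢𝟘 (2 * r) c≢0) G ⟨
      ∑ (λ x → G (c ↑ (2 * r) ⊗ x))               ≡⟨ ∑-frobenius^ k (λ x → G (c ↑ (2 * r) ⊗ x)) ⟨
      ∑ (λ x → G (c ↑ (2 * r) ⊗ x ↑ (q ^ k)))
        ≡⟨ ∑-cong′ (λ x → cong (λ e → G (c ↑ (2 * r) ⊗ x ↑ e)) q^k≡) ⟩
      ∑ (λ x → G (τ x))                           ≡⟨ ∑-cong′ flip ⟩
      ∑ (λ x → -ᶻ G x)                            ≡⟨ ∑-neg elems G ⟩
      -ᶻ ∑ G                                      ∎)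
      where
      c = ω ↑ a ⊗ b
      c≢0 : c ≢ 𝟘
      c≢0 = ⊗-≢𝟘 (ω↑≢𝟘 a) b≢0
      G : 𝔽 → ℤ
      G x = S x *ᶻ (κ (b ⊗ x) *ᶻ μ (c ⊗ x ⊕ z))
      -- With Q = 1 + 2r one has τ(x) = (cx)^(2r) x and cτ(x) = (cx)^Q. The first form shows the
      -- effect on S and κ, the second the invariance of μ.
      τ : 𝔽 → 𝔽
      τ x = c ↑ (2 * r) ⊗ x ↑ suc (2 * r)
      τ-𝟘 : τ 𝟘 ≡ 𝟘
      τ-𝟘 = trans (cong (c ↑ (2 * r) ⊗_) (R.zeroˡ _)) (R.zeroʳ _)
      τ-factor : ∀ x e → b ⊗ x ≡ ω ↑ e → τ x ≡ ω ↑ ((1 + 2 * A) * H) ⊗ (ω ↑ (2 * r * e) ⊗ x)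
      τ-factor x e bx≡ = begin
        c ↑ (2 * r) ⊗ (x ⊗ x ↑ (2 * r))
          ≡⟨ solve 3 (λ c x y → c :* (x :* y) := (c :* y) :* x) refl (c ↑ (2 * r)) x (x ↑ (2 * r)) ⟩
        c ↑ (2 * r) ⊗ x ↑ (2 * r) ⊗ x      ≡⟨ cong (_⊗ x) (↑-⊗ c x (2 * r)) ⟨
        (ω ↑ a ⊗ b ⊗ x) ↑ (2 * r) ⊗ x
          ≡⟨ cong (λ t → t ↑ (2 * r) ⊗ x) (trans (R.*-assoc (ω ↑ a) b x) (cong (ω ↑ a ⊗_) bx≡)) ⟩
        (ω ↑ a ⊗ ω ↑ e) ↑ (2 * r) ⊗ x      ≡⟨ cong (_⊗ x) (↑-⊗ (ω ↑ a) (ω ↑ e) (2 * r)) ⟩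
        ω ↑ a ↑ (2 * r) ⊗ ω ↑ e ↑ (2 * r) ⊗ x
          ≡⟨ cong₂ (λ s t → s ⊗ t ⊗ x) (trans (sym (↑-* ω (2 * r) a)) (cong (ω ↑_) ra≡)) (sym (↑-* ω (2 * r) e)) ⟩
        ω ↑ ((1 + 2 * A) * H) ⊗ ω ↑ (2 * r * e) ⊗ x ≡⟨ R.*-assoc _ _ x ⟩
        ω ↑ ((1 + 2 * A) * H) ⊗ (ω ↑ (2 * r * e) ⊗ x) ∎
      κ-τ : ∀ x e → b ⊗ x ≡ ω ↑ e → κ (b ⊗ τ x) ≡ κ-exponent (e * (1 + 2 * r))
      κ-τ x e bx≡ = begin
        κ (b ⊗ τ x)                                            ≡⟨ cong (λ t → κ (b ⊗ t)) (τ-factor x e bx≡) ⟩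
        κ (b ⊗ (ω ↑ ((1 + 2 * A) * H) ⊗ (ω ↑ (2 * r * e) ⊗ x)))
          ≡⟨ cong κ (solve 4 (λ b x y z → b :* (x :* (y :* z)) := x :* (y :* (b :* z))) refl b (ω ↑ ((1 + 2 * A) * H)) (ω ↑ (2 * r * e)) x) ⟩
        κ (ω ↑ ((1 + 2 * A) * H) ⊗ (ω ↑ (2 * r * e) ⊗ (b ⊗ x)))
          ≡⟨ κ-shift (∣-trans f∣H (n∣m*n (1 + 2 * A))) _ ⟩
        κ (ω ↑ (2 * r * e) ⊗ (b ⊗ x))                          ≡⟨ cong (λ t → κ (ω ↑ (2 * r * e) ⊗ t)) bx≡ ⟩
        κ (ω ↑ (2 * r * e) ⊗ ω ↑ e)                            ≡⟨ cong κ (↑-+ ω (2 * r * e) e) ⟨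
        κ (ω ↑ (2 * r * e + e))                                ≡⟨ κ-↑ _ ⟩
        κ-exponent (2 * r * e + e)                             ≡⟨ cong κ-exponent (shape r e) ⟩
        κ-exponent (e * (1 + 2 * r))                           ∎
        where
        shape : ∀ r e → 2 * r * e + e ≡ e * (1 + 2 * r)
        shape = ℕ-solver.solve-∀
      κ-τ-≡ : ∀ x e → b ⊗ x ≡ ω ↑ e → κ (b ⊗ τ x) ≡ κ (b ⊗ x)
      κ-τ-≡ x e bx≡ = trans (κ-τ x e bx≡) (trans
        -- The logarithm of bx is multiplied by the odd number Q, which preserves divisibility by f,
        -- a power of 2.
        (indicator-⇔ (f ∣? (e * (1 + 2 * r))) (f ∣? e) (2^∣-cancel-odd s e r) (∣m⇒∣m*n (1 + 2 * r)))
        (sym (trans (cong κ bx≡) (κ-↑ e))))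
      -- For bx in K the factor (bx)^(2r) is an even power of ω^H, so only the odd power ω^(2ra)
      -- acts on the sign. Off b⁻¹K this fails, which is why T carries the factor κ.
      S-τ : ∀ x e → b ⊗ x ≡ ω ↑ (e * f) → S (τ x) ≡ -ᶻ S x
      S-τ x e bx≡ = begin
        S (τ x)                                                   ≡⟨ cong S (τ-factor x (e * f) bx≡) ⟩
        S (ω ↑ ((1 + 2 * A) * H) ⊗ (ω ↑ (2 * r * (e * f)) ⊗ x))  ≡⟨ S-shift (1 + 2 * A) _ ⟩
        sign (1 + 2 * A) *ᶻ S (ω ↑ (2 * r * (e * f)) ⊗ x)
          ≡⟨ cong₂ (λ i t → i *ᶻ S (ω ↑ t ⊗ x)) (sign-odd A) exponent ⟩
        -1ℤ *ᶻ S (ω ↑ (2 * (e * B) * H) ⊗ x)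
          ≡⟨ cong (-1ℤ *ᶻ_) (S-shift (2 * (e * B)) x) ⟩
        -1ℤ *ᶻ (sign (2 * (e * B)) *ᶻ S x)
          ≡⟨ cong (λ i → -1ℤ *ᶻ (i *ᶻ S x)) (sign-even (e * B)) ⟩
        -1ℤ *ᶻ (1ℤ *ᶻ S x)
          ≡⟨ trans (ℤ.-1*i≡-i _) (cong -ᶻ_ (ℤ.*-identityˡ (S x))) ⟩
        -ᶻ S x                                                    ∎
        where
        exponent : 2 * r * (e * f) ≡ 2 * (e * B) * H
        exponent = trans (shape r e f) (trans (cong (e *_) rf≡) (shape′ e B H))
          where
          shape : ∀ r e f → 2 * r * (e * f) ≡ e * (2 * r * f)
          shape = ℕ-solver.solve-∀
          shape′ : ∀ e B H → e * (2 * B * H) ≡ 2 * (e * B) * H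
          shape′ = ℕ-solver.solve-∀
      μ-τ : ∀ x → μ (c ⊗ τ x ⊕ z) ≡ μ (c ⊗ x ⊕ z)
      μ-τ x = begin
        μ (c ⊗ τ x ⊕ z)                    ≡⟨ cong (λ t → μ (t ⊕ z)) (sym (R.*-assoc c _ _)) ⟩
        μ (c ↑ suc (2 * r) ⊗ x ↑ suc (2 * r) ⊕ z) ≡⟨ cong (λ t → μ (t ⊕ z)) (↑-⊗ c x (suc (2 * r))) ⟨
        μ ((c ⊗ x) ↑ suc (2 * r) ⊕ z)      ≡⟨ cong (λ e → μ ((c ⊗ x) ↑ e ⊕ z)) q^k≡ ⟨
        μ ((c ⊗ x) ↑ (q ^ k) ⊕ z)          ≡⟨ μ-frobenius^ k (c ⊗ x) z ⟩
        μ (c ⊗ x ⊕ z)                      ∎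
      flip : ∀ x → G (τ x) ≡ -ᶻ G x
      flip x = [ (λ { refl → trans (cong G τ-𝟘) (trans G-𝟘 (sym (cong -ᶻ_ G-𝟘))) }) , nonzero ]′ (toSum (x ≟ 𝟘))
       where
       G-𝟘 : G 𝟘 ≡ 0ℤ
       G-𝟘 = cong (_*ᶻ (κ (b ⊗ 𝟘) *ᶻ μ (c ⊗ 𝟘 ⊕ z))) S-𝟘
       nonzero : x ≢ 𝟘 → G (τ x) ≡ -ᶻ G x
       nonzero x≢0 with e , bx≡ ← ω-primitive (b ⊗ x) (⊗-≢𝟘 b≢0 x≢0) = begin
        S (τ x) *ᶻ (κ (b ⊗ τ x) *ᶻ μ (c ⊗ τ x ⊕ z))
          ≡⟨ cong₂ (λ i j → S (τ x) *ᶻ (i *ᶻ j)) (κ-τ-≡ x e bx≡) (μ-τ x) ⟩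
        S (τ x) *ᶻ (κ (b ⊗ x) *ᶻ M)     ≡⟨ rearrange (S (τ x)) (κ (b ⊗ x)) M ⟩
        κ (b ⊗ x) *ᶻ S (τ x) *ᶻ M
          ≡⟨ cong (_*ᶻ M) (κ-*-cong (b ⊗ x) λ eq → let a , bx≡′ = κ≡1⇒ eq in S-τ x a bx≡′) ⟩
        κ (b ⊗ x) *ᶻ -ᶻ S x *ᶻ M        ≡⟨ rearrange′ (S x) (κ (b ⊗ x)) M ⟩
        -ᶻ G x ∎
        where
        M = μ (c ⊗ x ⊕ z)
        rearrange : ∀ s k m → s *ᶻ (k *ᶻ m) ≡ k *ᶻ s *ᶻ m
        rearrange = solve-∀
        rearrange′ : ∀ s k m → k *ᶻ -ᶻ s *ᶻ m ≡ -ᶻ (s *ᶻ (k *ᶻ m))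
        rearrange′ = solve-∀

    orthogonal : ∀ b c z → T b c z ≡ κ (c ⊗ inv b) *ᶻ T b c z
    orthogonal b c z with κ-bit (c ⊗ inv b)
    ... | inj₂ κ≡1 = sym (trans (cong (_*ᶻ T b c z) κ≡1) (ℤ.*-identityˡ _))
    ... | inj₁ κ≡0 = trans T≡0 (sym (cong (_*ᶻ T b c z) κ≡0))
      where
      nonzero : b ≢ 𝟘 → c ≢ 𝟘 → T b c z ≡ 0ℤ
      nonzero b≢0 c≢0 with a , eq ← ω-primitive (c ⊗ inv b) (⊗-≢𝟘 c≢0 (inv-≢𝟘 b≢0)) =
        trans (cong (λ t → T b t z) c≡) (T-vanish a z b≢0 λ f∣a →
          contradiction (trans (sym κ≡0) (trans (cong κ eq) (trans (κ-↑ a) (indicator-yes (f ∣? a) f∣a)))) λ ())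
        where
        c≡ : c ≡ ω ↑ a ⊗ b
        c≡ = begin
          c                   ≡⟨ inv-⊗-cancel b≢0 c ⟨
          inv b ⊗ (b ⊗ c)     ≡⟨ solve 3 (λ i b c → i :* (b :* c) := (c :* i) :* b) refl (inv b) b c ⟩
          c ⊗ inv b ⊗ b       ≡⟨ cong (_⊗ b) eq ⟩
          ω ↑ a ⊗ b           ∎

      T≡0 : T b c z ≡ 0ℤ
      T≡0 = [ (λ { refl → T-𝟘ˡ c z }) , (λ b≢0 →
              [ (λ { refl → T-𝟘ʳ b z }) , nonzero b≢0 ]′ (toSum (c ≟ 𝟘))) ]′ (toSum (b ≟ 𝟘))

    vμ-nonZero : ℤ.NonZero (+ order *ᶻ μ 𝟘)
    vμ-nonZero = ℤ.i*j≢0 (+ order) (μ 𝟘) {{subst (λ k → ℤ.NonZero (+ k)) (sym order≡1+n) _}} {{ℤ.>-nonZero μ-𝟘-positive}}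

    ∑-κ-correlation : ∀ {g} → g ≢ 𝟘 →
      ∑ (λ k → κ k *ᶻ ∑ (λ x → S (k ⊗ x) *ᶻ S (k ⊗ (g ⊕ ⊖ x)))) ≡ size
    ∑-κ-correlation = correlation-sum orthogonal {{vμ-nonZero}}

  -- From constant autocorrelation sums to skew Hadamard difference families

  module BlockDifferences
    {b : ℕ} (B : Fin b → 𝔽 → Set) (B? : ∀ i x → Dec (B i x)) where

    open ≡-Reasoning

    χ : Fin b → 𝔽 → ℤ
    χ i x = indicator (B? i x)

    Difference : 𝔽 → Fin b × 𝔽 × 𝔽 → Set
    Difference g (i , x , y) = B i x × B i y × x ≢ y × x ⊕ ⊖ y ≡ g

    difference? : ∀ g t → Dec (Difference g t)
    difference? g (i , x , y) = B? i x ×-dec (B? i y ×-dec (¬? (x ≟ y) ×-dec (x ⊕ ⊖ y ≟ g)))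

    -- For g ≠ 0 the last two conditions of `Difference` amount to y = x - g, so a delta collapses
    -- the sum over y.
    ∑-difference : ∀ {g} → g ≢ 𝟘 →
      ∑[ triples F b ] (λ t → indicator (difference? g t)) ≡
      ∑[ allFin b ] (λ i → ∑ (λ x → χ i x *ᶻ χ i (x ⊕ ⊖ g)))
    ∑-difference {g} g≢0 = trans (∑-triples b _) (∑-cong (allFin b) λ i → ∑-cong′ (inner i))
      where
      inner : ∀ i x → ∑ (λ y → indicator (difference? g (i , x , y))) ≡ χ i x *ᶻ χ i (x ⊕ ⊖ g)
      inner i x = begin
        ∑ (λ y → indicator (difference? g (i , x , y))) ≡⟨ ∑-cong′ factor ⟩
        ∑ (λ y → χ i x *ᶻ (δ (x ⊕ ⊖ g) y *ᶻ χ i y))     ≡⟨ ∑-*ˡ elems (χ i x) _ ⟩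
        χ i x *ᶻ ∑ (λ y → δ (x ⊕ ⊖ g) y *ᶻ χ i y)       ≡⟨ cong (χ i x *ᶻ_) (∑-δ-* (x ⊕ ⊖ g) (χ i)) ⟩
        χ i x *ᶻ χ i (x ⊕ ⊖ g)                          ∎
        where
        factor : ∀ y → indicator (difference? g (i , x , y)) ≡ χ i x *ᶻ (δ (x ⊕ ⊖ g) y *ᶻ χ i y)
        factor y = begin
          indicator (difference? g (i , x , y))
            ≡⟨ indicator-× (B? i x) (B? i y ×-dec (¬? (x ≟ y) ×-dec (x ⊕ ⊖ y ≟ g))) ⟩
          χ i x *ᶻ indicator (B? i y ×-dec (¬? (x ≟ y) ×-dec (x ⊕ ⊖ y ≟ g)))
            ≡⟨ cong (χ i x *ᶻ_) (indicator-× (B? i y) (¬? (x ≟ y) ×-dec (x ⊕ ⊖ y ≟ g))) ⟩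
          χ i x *ᶻ (χ i y *ᶻ indicator (¬? (x ≟ y) ×-dec (x ⊕ ⊖ y ≟ g)))
            ≡⟨ cong (λ n → χ i x *ᶻ (χ i y *ᶻ n)) (indicator-⇔ (¬? (x ≟ y) ×-dec (x ⊕ ⊖ y ≟ g)) (x ⊕ ⊖ g ≟ y)
                 (⊖-transpose ∘ proj₂)
                 (λ eq → difference-≢ g≢0 (⊖-transpose eq) , ⊖-transpose eq)) ⟩
          χ i x *ᶻ (χ i y *ᶻ δ (x ⊕ ⊖ g) y) ≡⟨ cong (χ i x *ᶻ_) (ℤ.*-comm (χ i y) _) ⟩
          χ i x *ᶻ (δ (x ⊕ ⊖ g) y *ᶻ χ i y) ∎

    isDifferenceFamily : ∀ k → (∀ i → ∑ (χ i) ≡ + k) →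
      (∀ {g g′} → g ≢ 𝟘 → g′ ≢ 𝟘 →
        ∑[ allFin b ] (λ i → ∑ (λ x → χ i x *ᶻ χ i (x ⊕ ⊖ g))) ≡
        ∑[ allFin b ] (λ i → ∑ (λ x → χ i x *ᶻ χ i (x ⊕ ⊖ g′)))) →
      ∃[ v ] ∃[ k ] ∃[ λ′ ] IsDifferenceFamily F b B v k λ′
    -- λ is taken to be the multiplicity of the difference `𝟙`; constancy transports it to every
    -- other nonzero g.
    isDifferenceFamily k ∑χ ∑χχ-constant = order , k , multiplicity 𝟙 , refl ,
      (λ i → subst (Count (B i) elems)
        (ℤ.+-injective (trans (proj₂ (proj₂ (count (B? i) elems))) (∑χ i)))
        (proj₁ (proj₂ (count (B? i) elems)))) ,
      (λ g g≢0 → subst (Count (Difference g) (triples F b))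
        (ℤ.+-injective (trans (multiplicity≡ g≢0) (trans (∑χχ-constant g≢0 (0≢1 ∘ sym)) (sym (multiplicity≡ (0≢1 ∘ sym))))))
        (proj₁ (proj₂ (differences g))))
      where
      differences : ∀ g → ∃[ n ] (Count (Difference g) (triples F b) n × + n ≡ ∑[ triples F b ] (λ t → indicator (difference? g t)))
      differences g = count (difference? g) (triples F b)
      multiplicity : 𝔽 → ℕ
      multiplicity g = proj₁ (differences g)
      multiplicity≡ : ∀ {g} → g ≢ 𝟘 → + multiplicity g ≡ ∑[ allFin b ] (λ i → ∑ (λ x → χ i x *ᶻ χ i (x ⊕ ⊖ g)))
      multiplicity≡ {g} g≢0 = trans (proj₂ (proj₂ (differences g))) (∑-difference g≢0)

  module SignedBlocks
    {b : ℕ} (B : Fin b → 𝔽 → Set) (σ : Fin b → 𝔽 → ℤ)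
    (σ-odd : ∀ i x → σ i (⊖ x) ≡ -ᶻ σ i x)
    (σ-bit : ∀ i {x} → x ≢ 𝟘 → σ i x ≡ 1ℤ ⊎ σ i x ≡ -1ℤ)
    (B⇒ : ∀ i x → B i x → σ i x ≡ 1ℤ)
    (B⇐ : ∀ i x → σ i x ≡ 1ℤ → B i x)
    where

    open ≡-Reasoning

    B? : ∀ i x → Dec (B i x)
    B? i x = map′ (B⇐ i x) (B⇒ i x) (σ i x ℤ.≟ 1ℤ)

    open BlockDifferences B B?

    autocorrelation : 𝔽 → Fin b → ℤ
    autocorrelation g i = ∑ (λ x → σ i x *ᶻ σ i (g ⊕ ⊖ x))

    σ-𝟘 : ∀ i → σ i 𝟘 ≡ 0ℤ
    σ-𝟘 i = x≡-x⇒x≡0 _ (trans (cong (σ i) (sym -0#≈0#)) (σ-odd i 𝟘))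

    B-skew : ∀ i → IsSkew F (B i)
    B-skew i = disjoint , (λ b → contradiction (trans (sym (B⇒ i 𝟘 b)) (σ-𝟘 i)) λ ()) , cover
      where
      disjoint : ∀ x → B i x → ¬ B i (⊖ x)
      disjoint x b b⁻ = contradiction
        (trans (sym (B⇒ i (⊖ x) b⁻)) (trans (σ-odd i x) (cong -ᶻ_ (B⇒ i x b)))) λ ()
      cover : ∀ x → x ≢ 𝟘 → B i x ⊎ B i (⊖ x)
      cover x x≢0 = Sum.map (B⇐ i x) (λ eq → B⇐ i (⊖ x) (trans (σ-odd i x) (cong -ᶻ_ eq))) (σ-bit i x≢0)

    -- χ is (σ + 1)/2 away from 0 and 0 at 0. The term `δ 𝟘 x` corrects the latter, and doubling
    -- keeps the identity in ℤ.
    2χ≡ : ∀ i x → + 2 *ᶻ χ i x ≡ σ i x +ᶻ (1ℤ -ᶻ δ 𝟘 x)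
    2χ≡ i x = [ (λ { refl → zero-case }) , nonzero ]′ (toSum (x ≟ 𝟘))
      where
      zero-case : + 2 *ᶻ χ i 𝟘 ≡ σ i 𝟘 +ᶻ (1ℤ -ᶻ δ 𝟘 𝟘)
      zero-case = trans (cong (+ 2 *ᶻ_) (indicator-no (B? i 𝟘) (proj₁ (proj₂ (B-skew i)))))
        (sym (cong₂ (λ s t → s +ᶻ (1ℤ -ᶻ t)) (σ-𝟘 i) (δ-refl 𝟘)))
      nonzero : x ≢ 𝟘 → + 2 *ᶻ χ i x ≡ σ i x +ᶻ (1ℤ -ᶻ δ 𝟘 x)
      nonzero x≢0 = [ inside , outside ]′ (σ-bit i x≢0)
        where
        inside : σ i x ≡ 1ℤ → + 2 *ᶻ χ i x ≡ σ i x +ᶻ (1ℤ -ᶻ δ 𝟘 x)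
        inside eq = trans (cong (+ 2 *ᶻ_) (indicator-yes (B? i x) (B⇐ i x eq)))
          (sym (cong₂ (λ s t → s +ᶻ (1ℤ -ᶻ t)) eq (δ-≢ (x≢0 ∘ sym))))
        outside : σ i x ≡ -1ℤ → + 2 *ᶻ χ i x ≡ σ i x +ᶻ (1ℤ -ᶻ δ 𝟘 x)
        outside eq = trans (cong (+ 2 *ᶻ_) (indicator-no (B? i x) λ b → contradiction (trans (sym eq) (B⇒ i x b)) λ ()))
          (sym (cong₂ (λ s t → s +ᶻ (1ℤ -ᶻ t)) eq (δ-≢ (x≢0 ∘ sym))))

    ∑-σ : ∀ i → ∑ (σ i) ≡ 0ℤ
    ∑-σ i = ∑-odd (σ i) (σ-odd i)

    ∑-1 : ∑ (λ _ → 1ℤ) ≡ + order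
    ∑-1 = trans (∑-const elems 1ℤ) (ℤ.*-identityʳ _)

    ∑-χ : ∀ i → + 2 *ᶻ ∑ (χ i) ≡ + order -ᶻ 1ℤ
    ∑-χ i = begin
      + 2 *ᶻ ∑ (χ i)                                        ≡⟨ ∑-*ˡ elems (+ 2) (χ i) ⟨
      ∑ (λ x → + 2 *ᶻ χ i x)                                ≡⟨ ∑-cong′ (2χ≡ i) ⟩
      ∑ (λ x → σ i x +ᶻ (1ℤ -ᶻ δ 𝟘 x))                     ≡⟨ ∑-+ elems _ _ ⟩
      ∑ (σ i) +ᶻ ∑ (λ x → 1ℤ -ᶻ δ 𝟘 x)
        ≡⟨ cong₂ _+ᶻ_ (∑-σ i) (trans (∑-+ elems _ _) (cong₂ _+ᶻ_ ∑-1 (trans (∑-neg elems (δ 𝟘)) (cong -ᶻ_ (∑-δ 𝟘))))) ⟩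
      0ℤ +ᶻ (+ order -ᶻ 1ℤ)                                 ≡⟨ ℤ.+-identityˡ _ ⟩
      + order -ᶻ 1ℤ                                         ∎

    -- Expand the product of two copies of `2χ≡`. The linear terms in σ sum to 0, their corrections
    -- at x = g and x = 0 are -σ(g) and σ(g), and the constants give `order` minus 2. The sign of
    -- the correlation comes from σ(x - g) = -σ(g - x).
    4*∑-χχ : ∀ {g} → g ≢ 𝟘 → ∀ i → + 4 *ᶻ ∑ (λ x → χ i x *ᶻ χ i (x ⊕ ⊖ g)) ≡
      -ᶻ autocorrelation g i +ᶻ (+ order -ᶻ + 2)
    4*∑-χχ {g} g≢0 i = begin
      + 4 *ᶻ ∑ (λ x → χ i x *ᶻ χ i (x ⊕ ⊖ g))  ≡⟨ ∑-*ˡ elems (+ 4) _ ⟨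
      ∑ (λ x → + 4 *ᶻ (χ i x *ᶻ χ i (x ⊕ ⊖ g))) ≡⟨ ∑-cong′ pointwise ⟩
      ∑ (λ x → (-ᶻ (s₀ x *ᶻ σ i (g ⊕ ⊖ x)) +ᶻ (s₀ x +ᶻ -ᶻ (δ g x *ᶻ s₀ x))) +ᶻ
               ((s₁ x +ᶻ -ᶻ (δ 𝟘 x *ᶻ s₁ x)) +ᶻ ((1ℤ -ᶻ δ 𝟘 x) +ᶻ (-ᶻ δ g x +ᶻ δ 𝟘 x *ᶻ δ g x))))
        ≡⟨ trans (∑-+ elems _ _) (cong₂ _+ᶻ_
             (trans (∑-+ elems _ _) (cong₂ _+ᶻ_ (∑-neg elems _) (trans (∑-+ elems _ _) (cong₂ _+ᶻ_ (∑-σ i) (trans (∑-neg elems _) (cong -ᶻ_ (∑-δ-* g s₀)))))))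
             (trans (∑-+ elems _ _) (cong₂ _+ᶻ_
               (trans (∑-+ elems _ _) (cong₂ _+ᶻ_ (trans (∑-shift (⊖ g) (σ i)) (∑-σ i)) (trans (∑-neg elems _) (cong -ᶻ_ (trans (∑-δ-* 𝟘 s₁) s₁-𝟘)))))
               (trans (∑-+ elems _ _) (cong₂ _+ᶻ_
                 (trans (∑-+ elems _ _) (cong₂ _+ᶻ_ ∑-1 (trans (∑-neg elems (δ 𝟘)) (cong -ᶻ_ (∑-δ 𝟘)))))
                 (trans (∑-+ elems _ _) (cong₂ _+ᶻ_ (trans (∑-neg elems (δ g)) (cong -ᶻ_ (∑-δ g))) (trans (∑-δ-* 𝟘 (δ g)) (δ-≢ g≢0))))))))) ⟩
      (-ᶻ ρ +ᶻ (0ℤ +ᶻ -ᶻ s₀ g)) +ᶻ ((0ℤ +ᶻ -ᶻ (-ᶻ s₀ g)) +ᶻ ((+ order -ᶻ 1ℤ) +ᶻ (-1ℤ +ᶻ 0ℤ)))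
        ≡⟨ collect ρ (s₀ g) (+ order) ⟩
      -ᶻ ρ +ᶻ (+ order -ᶻ + 2) ∎
      where
      s₀ s₁ : 𝔽 → ℤ
      s₀ = σ i
      s₁ x = σ i (x ⊕ ⊖ g)
      ρ = autocorrelation g i
      s₁-𝟘 : s₁ 𝟘 ≡ -ᶻ s₀ g
      s₁-𝟘 = trans (cong (σ i) (R.+-identityˡ _)) (σ-odd i g)
      s₁≡ : ∀ x → s₁ x ≡ -ᶻ σ i (g ⊕ ⊖ x)
      s₁≡ x = trans (cong (σ i) (begin
        x ⊕ ⊖ g            ≡⟨ cong (_⊕ ⊖ g) (-‿involutive x) ⟨
        ⊖ (⊖ x) ⊕ ⊖ g      ≡⟨ R.+-comm _ _ ⟩
        ⊖ g ⊕ ⊖ (⊖ x)      ≡⟨ ⁻¹-∙-comm g (⊖ x) ⟩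
        ⊖ (g ⊕ ⊖ x)        ∎)) (σ-odd i _)
      δ-shift : ∀ x → δ 𝟘 (x ⊕ ⊖ g) ≡ δ g x
      δ-shift x = indicator-⇔ (𝟘 ≟ x ⊕ ⊖ g) (g ≟ x)
        (λ eq → trans (sym (R.+-identityˡ g)) (trans (cong (_⊕ g) eq) (⊖-⊕-cancel x g)))
        (λ { refl → sym (R.-‿inverseʳ g) })
      expand : ∀ a b t i j → t ≡ -ᶻ b → (a +ᶻ (1ℤ -ᶻ i)) *ᶻ (t +ᶻ (1ℤ -ᶻ j)) ≡
        (-ᶻ (a *ᶻ b) +ᶻ (a +ᶻ -ᶻ (j *ᶻ a))) +ᶻ ((t +ᶻ -ᶻ (i *ᶻ t)) +ᶻ ((1ℤ -ᶻ i) +ᶻ (-ᶻ j +ᶻ i *ᶻ j)))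
      expand a b _ i j refl = ring a b i j
        where
        ring : ∀ a b i j → (a +ᶻ (1ℤ -ᶻ i)) *ᶻ (-ᶻ b +ᶻ (1ℤ -ᶻ j)) ≡
          (-ᶻ (a *ᶻ b) +ᶻ (a +ᶻ -ᶻ (j *ᶻ a))) +ᶻ ((-ᶻ b +ᶻ -ᶻ (i *ᶻ -ᶻ b)) +ᶻ ((1ℤ -ᶻ i) +ᶻ (-ᶻ j +ᶻ i *ᶻ j)))
        ring = solve-∀
      double : ∀ a b → + 4 *ᶻ (a *ᶻ b) ≡ (+ 2 *ᶻ a) *ᶻ (+ 2 *ᶻ b)
      double = solve-∀
      pointwise : ∀ x → + 4 *ᶻ (χ i x *ᶻ χ i (x ⊕ ⊖ g)) ≡
        (-ᶻ (s₀ x *ᶻ σ i (g ⊕ ⊖ x)) +ᶻ (s₀ x +ᶻ -ᶻ (δ g x *ᶻ s₀ x))) +ᶻ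
        ((s₁ x +ᶻ -ᶻ (δ 𝟘 x *ᶻ s₁ x)) +ᶻ ((1ℤ -ᶻ δ 𝟘 x) +ᶻ (-ᶻ δ g x +ᶻ δ 𝟘 x *ᶻ δ g x)))
      pointwise x = begin
        + 4 *ᶻ (χ i x *ᶻ χ i (x ⊕ ⊖ g))                ≡⟨ double (χ i x) (χ i (x ⊕ ⊖ g)) ⟩
        (+ 2 *ᶻ χ i x) *ᶻ (+ 2 *ᶻ χ i (x ⊕ ⊖ g))
          ≡⟨ cong₂ _*ᶻ_ (2χ≡ i x) (trans (2χ≡ i (x ⊕ ⊖ g)) (cong (λ j → s₁ x +ᶻ (1ℤ -ᶻ j)) (δ-shift x))) ⟩
        (s₀ x +ᶻ (1ℤ -ᶻ δ 𝟘 x)) *ᶻ (s₁ x +ᶻ (1ℤ -ᶻ δ g x))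
          ≡⟨ expand (s₀ x) (σ i (g ⊕ ⊖ x)) (s₁ x) (δ 𝟘 x) (δ g x) (s₁≡ x) ⟩
        _ ∎
      collect : ∀ A s v → (-ᶻ A +ᶻ (0ℤ +ᶻ -ᶻ s)) +ᶻ ((0ℤ +ᶻ -ᶻ (-ᶻ s)) +ᶻ ((v -ᶻ 1ℤ) +ᶻ (-1ℤ +ᶻ 0ℤ))) ≡ -ᶻ A +ᶻ (v -ᶻ + 2)
      collect = solve-∀

    isSkewHadamardDF : ∀ k c → order ≡ suc (2 * k) →
      (∀ {g} → g ≢ 𝟘 → ∑[ allFin b ] (autocorrelation g) ≡ c) → IsSkewHadamardDF F b B
    isSkewHadamardDF k c order≡ constant = isDifferenceFamily k ∑-χ≡ ∑-χχ-constant , B-skew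
      where
      ∑-χ≡ : ∀ i → ∑ (χ i) ≡ + k
      ∑-χ≡ i = ℤ.*-cancelˡ-≡ (+ 2) (∑ (χ i)) (+ k) (begin
        + 2 *ᶻ ∑ (χ i)      ≡⟨ ∑-χ i ⟩
        + order -ᶻ 1ℤ       ≡⟨ cong (λ v → + v -ᶻ 1ℤ) order≡ ⟩
        + (2 * k)           ≡⟨ ℤ.pos-* 2 k ⟩
        + 2 *ᶻ + k          ∎)
      ∑-χχ : 𝔽 → ℤ
      ∑-χχ g = ∑[ allFin b ] (λ i → ∑ (λ x → χ i x *ᶻ χ i (x ⊕ ⊖ g)))
      4*∑∑ : ∀ {g} → g ≢ 𝟘 → + 4 *ᶻ ∑-χχ g ≡ -ᶻ c +ᶻ + length (allFin b) *ᶻ (+ order -ᶻ + 2)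
      4*∑∑ {g} g≢0 = begin
        + 4 *ᶻ ∑-χχ g ≡⟨ ∑-*ˡ (allFin b) (+ 4) (λ i → ∑ (λ x → χ i x *ᶻ χ i (x ⊕ ⊖ g))) ⟨
        ∑[ allFin b ] (λ i → + 4 *ᶻ ∑ (λ x → χ i x *ᶻ χ i (x ⊕ ⊖ g))) ≡⟨ ∑-cong (allFin b) (4*∑-χχ g≢0) ⟩
        ∑[ allFin b ] (λ i → -ᶻ autocorrelation g i +ᶻ (+ order -ᶻ + 2))
          ≡⟨ ∑-+ (allFin b) (λ i → -ᶻ autocorrelation g i) _ ⟩
        ∑[ allFin b ] (λ i → -ᶻ autocorrelation g i) +ᶻ ∑[ allFin b ] (λ _ → + order -ᶻ + 2)
          ≡⟨ cong₂ _+ᶻ_ (trans (∑-neg (allFin b) (autocorrelation g)) (cong -ᶻ_ (constant g≢0))) (∑-const (allFin b) _) ⟩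
        -ᶻ c +ᶻ + length (allFin b) *ᶻ (+ order -ᶻ + 2) ∎
      ∑-χχ-constant : ∀ {g g′} → g ≢ 𝟘 → g′ ≢ 𝟘 → ∑-χχ g ≡ ∑-χχ g′
      ∑-χχ-constant {g} {g′} g≢0 g′≢0 = ℤ.*-cancelˡ-≡ (+ 4) (∑-χχ g) (∑-χχ g′) (trans (4*∑∑ g≢0) (sym (4*∑∑ g′≢0)))

  -- The blocks D_h as level sets of dilations of S

  module Blocks (ω : 𝔽) (ω-primitive : IsPrimitive F ω)
    (w s q m : ℕ) (q≡ : q ≡ suc (4 * 2 ^ w * (1 + 2 * m)))
    (q-additive : Additive q) (order≡q^2^s : order ≡ q ^ (2 ^ s)) where

    open Construction ω ω-primitive w s q m q≡ q-additive order≡q^2^s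

    open ≡-Reasoning

    ω⁻ : ℕ → 𝔽
    ω⁻ h = inv (ω ↑ h)

    ω⁻-+ : ∀ a b → ω⁻ (a + b) ≡ ω⁻ a ⊗ ω⁻ b
    ω⁻-+ a b = trans (cong inv (↑-+ ω a b)) (inv-⊗ (ω↑≢𝟘 a) (ω↑≢𝟘 b))

    Sₕ : ℕ → 𝔽 → ℤ
    Sₕ h x = S (ω⁻ h ⊗ x)

    Sₕ-half : ∀ h x → Sₕ (H + h) x ≡ -ᶻ Sₕ h x
    Sₕ-half h x = begin
      S y                               ≡⟨ ℤ.neg-involutive (S y) ⟨
      -ᶻ (-ᶻ S y)                       ≡⟨ cong -ᶻ_ (trans (sym (ℤ.-1*i≡-i (S y))) (sym (S-shift 1 y))) ⟩
      -ᶻ S (ω ↑ (1 * H) ⊗ y)            ≡⟨ cong (λ t → -ᶻ S t) cancel ⟩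
      -ᶻ S (ω⁻ h ⊗ x)                   ∎
      where
      y = ω⁻ (H + h) ⊗ x
      cancel : ω ↑ (1 * H) ⊗ y ≡ ω⁻ h ⊗ x
      cancel = begin
        ω ↑ (1 * H) ⊗ (ω⁻ (H + h) ⊗ x)      ≡⟨ cong₂ (λ e t → ω ↑ e ⊗ (t ⊗ x)) (ℕ.*-identityˡ H) (ω⁻-+ H h) ⟩
        ω ↑ H ⊗ (ω⁻ H ⊗ ω⁻ h ⊗ x)           ≡⟨ cong (ω ↑ H ⊗_) (R.*-assoc (ω⁻ H) (ω⁻ h) x) ⟩
        ω ↑ H ⊗ (ω⁻ H ⊗ (ω⁻ h ⊗ x))         ≡⟨ ⊗-inv-cancel (ω↑≢𝟘 H) _ ⟩
        ω⁻ h ⊗ x                            ∎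

    Sₕ-odd : ∀ h x → Sₕ h (⊖ x) ≡ -ᶻ Sₕ h x
    Sₕ-odd h x = trans (cong S (sym (-‿distribʳ-* (ω⁻ h) x))) (S-odd _)

    S-bit : ∀ x → x ≢ 𝟘 → S x ≡ 1ℤ ⊎ S x ≡ -1ℤ
    S-bit = 𝔽-by-log (λ 0≢0 → contradiction refl 0≢0) (λ e _ →
      subst (λ i → i ≡ 1ℤ ⊎ i ≡ -1ℤ) (sym (S-↑ e)) (sign-bit (e / H)))

    Sₕ-bit : ∀ h {x} → x ≢ 𝟘 → Sₕ h x ≡ 1ℤ ⊎ Sₕ h x ≡ -1ℤ
    Sₕ-bit h x≢0 = S-bit _ (⊗-≢𝟘 (inv-≢𝟘 (ω↑≢𝟘 h)) x≢0)

    module _ {g : 𝔽} (g≢0 : g ≢ 𝟘) where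

      autocorrelation : 𝔽 → ℤ
      autocorrelation k = ∑ (λ x → S (k ⊗ x) *ᶻ S (k ⊗ (g ⊕ ⊖ x)))

      κ-ω⁻ : ∀ ℓ → κ (ω⁻ (f * ℓ)) ≡ 1ℤ
      κ-ω⁻ ℓ = trans (κ-inv (ω ↑ (f * ℓ))) (trans (κ-↑ (f * ℓ)) (indicator-yes (f ∣? (f * ℓ)) (m∣m*n ℓ)))

      ∑-κ-rotate : ∀ ℓ → ∑ (λ k → κ k *ᶻ autocorrelation (ω⁻ (f * ℓ) ⊗ k)) ≡ size
      ∑-κ-rotate ℓ = begin
        ∑ (λ k → κ k *ᶻ autocorrelation (ω⁻ (f * ℓ) ⊗ k))
          ≡⟨ ∑-cong′ (λ k → cong (_*ᶻ autocorrelation (ω⁻ (f * ℓ) ⊗ k)) (κ-⊗ (κ-ω⁻ ℓ) k)) ⟨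
        ∑ (λ k → κ (ω⁻ (f * ℓ) ⊗ k) *ᶻ autocorrelation (ω⁻ (f * ℓ) ⊗ k))
          ≡⟨ ∑-scale (inv-≢𝟘 (ω↑≢𝟘 (f * ℓ))) (λ k → κ k *ᶻ autocorrelation k) ⟩
        ∑ (λ k → κ k *ᶻ autocorrelation k)                      ≡⟨ ∑-κ-correlation g≢0 ⟩
        size                                       ∎

      autocorrelation-periodic : ∀ i → autocorrelation (ω⁻ (f * (i + L))) ≡ autocorrelation (ω⁻ (f * i))
      autocorrelation-periodic i = ∑-cong′ λ x →
        trans (cong₂ _*ᶻ_ (half x) (half (g ⊕ ⊖ x))) (neg-neg (Sₕ (f * i) x) (Sₕ (f * i) (g ⊕ ⊖ x)))
        where
        shape : ∀ f i L → f * (i + L) ≡ L * f + f * i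
        shape = ℕ-solver.solve-∀
        neg-neg : ∀ a b → -ᶻ a *ᶻ -ᶻ b ≡ a *ᶻ b
        neg-neg = solve-∀
        half : ∀ x → Sₕ (f * (i + L)) x ≡ -ᶻ Sₕ (f * i) x
        half x = trans (cong (λ h → Sₕ h x) (shape f i L)) (Sₕ-half (f * i) x)

      -- An element of K has the form ω^(-fa), so multiplication by it rotates the index ℓ by a, and
      -- the summand has period L.
      ∑-autocorrelation-coset : ∀ k → κ k ≡ 1ℤ →
        ∑[ upTo L ] (λ ℓ → autocorrelation (ω⁻ (f * ℓ) ⊗ k)) ≡ ∑[ upTo L ] (λ ℓ → autocorrelation (ω⁻ (f * ℓ)))
      ∑-autocorrelation-coset k κk≡1 =
        trans (∑-cong (upTo L) (λ ℓ → cong autocorrelation (shift ℓ)))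
          (∑-cyclic L (λ ℓ → autocorrelation (ω⁻ (f * ℓ))) autocorrelation-periodic a)
        where
        log-inv = κ≡1⇒ (trans (κ-inv k) κk≡1)
        a = proj₁ log-inv
        shift : ∀ ℓ → ω⁻ (f * ℓ) ⊗ k ≡ ω⁻ (f * (a + ℓ))
        shift ℓ = begin
          ω⁻ (f * ℓ) ⊗ k
            ≡⟨ cong (ω⁻ (f * ℓ) ⊗_) (trans (sym (inv-involutive k)) (cong inv (proj₂ log-inv))) ⟩
          ω⁻ (f * ℓ) ⊗ ω⁻ (a * f)   ≡⟨ ω⁻-+ (f * ℓ) (a * f) ⟨
          ω⁻ (f * ℓ + a * f)        ≡⟨ cong ω⁻ (shape f ℓ a) ⟩
          ω⁻ (f * (a + ℓ))          ∎
          where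
          shape : ∀ f ℓ a → f * ℓ + a * f ≡ f * (a + ℓ)
          shape = ℕ-solver.solve-∀

      -- The autocorrelation is invariant under k ↦ ω^H k, where H = f L, so averaging it over the
      -- support of κ, which is generated by ω^f, amounts to averaging over ω^{-fℓ} with ℓ < L.
      ∑-autocorrelation : ∑[ upTo L ] (λ ℓ → autocorrelation (ω⁻ (f * ℓ))) ≡ + L
      ∑-autocorrelation = ℤ.*-cancelˡ-≡ size (∑[ upTo L ] p) (+ L) (begin
        size *ᶻ ∑[ upTo L ] p                                             ≡⟨ ∑-*ʳ elems (∑[ upTo L ] p) κ ⟨
        ∑ (λ k → κ k *ᶻ ∑[ upTo L ] p)
          ≡⟨ ∑-cong′ (λ k → κ-*-cong k (∑-autocorrelation-coset k)) ⟨
        ∑ (λ k → κ k *ᶻ ∑[ upTo L ] (λ ℓ → autocorrelation (ω⁻ (f * ℓ) ⊗ k)))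
          ≡⟨ ∑-cong′ (λ k → ∑-*ˡ (upTo L) (κ k) (λ ℓ → autocorrelation (ω⁻ (f * ℓ) ⊗ k))) ⟨
        ∑ (λ k → ∑[ upTo L ] (λ ℓ → κ k *ᶻ autocorrelation (ω⁻ (f * ℓ) ⊗ k)))
          ≡⟨ ∑-swap elems (upTo L) (λ k ℓ → κ k *ᶻ autocorrelation (ω⁻ (f * ℓ) ⊗ k)) ⟩
        ∑[ upTo L ] (λ ℓ → ∑ (λ k → κ k *ᶻ autocorrelation (ω⁻ (f * ℓ) ⊗ k)))
          ≡⟨ ∑-cong (upTo L) ∑-κ-rotate ⟩
        ∑[ upTo L ] (λ _ → size)                               ≡⟨ ∑-const (upTo L) size ⟩
        + length (upTo L) *ᶻ size                              ≡⟨ cong (λ l → + l *ᶻ size) (length-upTo L) ⟩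
        + L *ᶻ size                                            ≡⟨ ℤ.*-comm (+ L) size ⟩
        size *ᶻ + L                                            ∎)
        where
        p : ℕ → ℤ
        p ℓ = autocorrelation (ω⁻ (f * ℓ))

    Block : ℕ → 𝔽 → Set
    Block h = D F ω (2 * H) h

    N/2≡H : 2 * H / 2 ≡ H
    N/2≡H = trans (cong (_/ 2) (ℕ.*-comm 2 H)) (m*n/n≡m H 2)

    block⇒ : ∀ h x → Block h x → Sₕ h x ≡ 1ℤ
    block⇒ h x (j , k , j<N/2 , refl) = begin
      S (ω⁻ h ⊗ ω ↑ (h + j + 2 * H * k))            ≡⟨ cong (λ e → S (ω⁻ h ⊗ ω ↑ e)) (shape h j H k) ⟩
      S (ω⁻ h ⊗ ω ↑ (h + (2 * k * H + j)))          ≡⟨ cong (λ t → S (ω⁻ h ⊗ t)) (↑-+ ω h _) ⟩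
      S (ω⁻ h ⊗ (ω ↑ h ⊗ ω ↑ (2 * k * H + j)))      ≡⟨ cong S (inv-⊗-cancel (ω↑≢𝟘 h) _) ⟩
      S (ω ↑ (2 * k * H + j))                       ≡⟨ S-↑ (2 * k * H + j) ⟩
      sg (2 * k * H + j)                            ≡⟨ sg-shift (2 * k) j ⟩
      sign (2 * k) *ᶻ sg j
        ≡⟨ cong₂ (λ i l → i *ᶻ sign l) (sign-even k) (m<n⇒m/n≡0 (subst (j <_) N/2≡H j<N/2)) ⟩
      1ℤ                                            ∎
      where
      shape : ∀ h j H k → h + j + 2 * H * k ≡ h + (2 * k * H + j)
      shape = ℕ-solver.solve-∀

    -- For the logarithm e of ω^(-h) x, the remainder modulo H serves as j. The quotient is even
    -- because the sign is 1, and half of it serves as k.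
    block⇐ : ∀ h x → Sₕ h x ≡ 1ℤ → Block h x
    block⇐ h x Sₕ≡1 =
      e % H , k , subst (e % H <_) (sym N/2≡H) (m%n<n e H) , (begin
        x                                ≡⟨ ⊗-inv-cancel (ω↑≢𝟘 h) x ⟨
        ω ↑ h ⊗ (ω⁻ h ⊗ x)               ≡⟨ cong (ω ↑ h ⊗_) y≡ ⟩
        ω ↑ h ⊗ ω ↑ e                    ≡⟨ ↑-+ ω h e ⟨
        ω ↑ (h + e)                      ≡⟨ cong (λ i → ω ↑ (h + i)) (m≡m%n+[m/n]*n e H) ⟩
        ω ↑ (h + (e % H + e / H * H))    ≡⟨ cong (λ l → ω ↑ (h + (e % H + l * H))) e/H≡2k ⟩
        ω ↑ (h + (e % H + 2 * k * H))    ≡⟨ cong (ω ↑_) (shape h (e % H) k H) ⟩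
        ω ↑ (h + e % H + 2 * H * k)      ∎)
      where
      log = ω-primitive (ω⁻ h ⊗ x) (λ y≡0 → contradiction (trans (sym Sₕ≡1) (trans (cong S y≡0) S-𝟘)) λ ())
      e = proj₁ log
      y≡ = proj₂ log
      half = sign≡1⇒even (e / H) (trans (sym (S-↑ e)) (trans (cong S (sym y≡)) Sₕ≡1))
      k = proj₁ half
      e/H≡2k = proj₂ half
      shape : ∀ h r k H → h + (r + 2 * k * H) ≡ h + r + 2 * H * k
      shape = ℕ-solver.solve-∀

    skewHadamardDF : IsSkewHadamardDF F L (λ ℓ → Block (f * toℕ ℓ))
    skewHadamardDF = SignedBlocks.isSkewHadamardDF
      (λ ℓ → Block (f * toℕ ℓ)) (λ ℓ → Sₕ (f * toℕ ℓ))
      (λ ℓ → Sₕ-odd (f * toℕ ℓ)) (λ ℓ → Sₕ-bit (f * toℕ ℓ))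
      (λ ℓ → block⇒ (f * toℕ ℓ)) (λ ℓ → block⇐ (f * toℕ ℓ))
      -- The block size is n/2, and L is the common value of the autocorrelation sums.
      ((1 + 2 * o) * H) (+ L)
      (trans order≡1+n (cong suc (trans n≡ (ℕ.*-assoc 2 (1 + 2 * o) H))))
      (λ g≢0 → trans (∑-allFin L (λ ℓ → autocorrelation g≢0 (ω⁻ (f * ℓ)))) (∑-autocorrelation g≢0))

-- The theorem in its original parameters

open import Defs using (Carrier; order; IsPrimePower)

theorem3p6 : (u q t : ℕ) → u ≥ 2 → IsPrimePower q
    → (∃[ m ] (q ≡ 2 ^ u + 1 + m * 2 ^ (u + 1)))
    → t ≥ u + 1
    → (F : FiniteField) → order F ≡ q ^ (2 ^ (t ∸ u))
    → (ω : Carrier F) → IsPrimitive F ω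
    → IsSkewHadamardDF F (2 ^ (u ∸ 1)) (λ ℓ → D F ω (2 ^ t) (2 ^ (t ∸ u) * toℕ ℓ))
theorem3p6 (suc (suc w)) q t (s≤s (s≤s z≤n)) (p , k , p-prime , _ , q≡p^k) (m , q≡) t≥u+1 F order≡ ω ω-primitive =
  subst (λ N → IsSkewHadamardDF F (2 * 2 ^ w) (λ ℓ → D F ω N (2 ^ s * toℕ ℓ))) (sym 2^t≡2H)
    (Blocks.skewHadamardDF F ω ω-primitive w s q m q≡1+4W·odd q-additive order≡)
  where
  u s : ℕ
  u = suc (suc w)
  s = t ∸ u
  q-additive : FieldProperties.Additive F q
  q-additive = subst (FieldProperties.Additive F) (sym q≡p^k)
    (FieldProperties.additive-primePower F {m = k} {k = 2 ^ s} p-prime (trans order≡ (cong (_^ (2 ^ s)) q≡p^k)))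
  q≡1+4W·odd : q ≡ suc (4 * 2 ^ w * (1 + 2 * m))
  q≡1+4W·odd = trans q≡ (trans
    (cong (λ W → 2 * (2 * 2 ^ w) + 1 + m * (2 * (2 * W))) (ℕ.^-distribˡ-+-* 2 w 1))
    (shape (2 ^ w) m))
    where
    shape : ∀ W m → 2 * (2 * W) + 1 + m * (2 * (2 * (W * 2))) ≡ suc (4 * W * (1 + 2 * m))
    shape = ℕ-solver.solve-∀
  2^t≡2H : 2 ^ t ≡ 2 * (2 * 2 ^ w * 2 ^ s)
  2^t≡2H = trans (cong (2 ^_) (sym (ℕ.m+[n∸m]≡n (ℕ.≤-trans (ℕ.m≤m+n u 1) t≥u+1))))
    (trans (ℕ.^-distribˡ-+-* 2 u s) (ℕ.*-assoc 2 (2 * 2 ^ w) (2 ^ s)))
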